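{- Let $f:\{0,1\}^n\to\mathbb{C}$ have affine support of dimension $r$ with free variables $x_1,\dots,x_r$, where on $\mathrm{supp}(f)$ each variable satisfies $x_i\equiv\sum_{j=1}^r a_{ij}x_j+b_i \pmod 2$ ($1\le i\le n$), with $a_{ij},b_i\in\{0,1\}$, $(a_{ij})_{1\le i,j\le r}=I_r$ and $b_1=\dots=b_r=0$. Suppose \[f=\lambda\cdot\chi_{\mathrm{supp}(f)}\cdot\alpha^{L(x)+2Q(x)+4H(x)},\] where $\lambda\ne0$, $\alpha=e^{\pi i/4}$, $L(x)=\sum_{j=1}^r c_jx_j$, $Q(x)=\sum_{1\le j<k\le r}c_{jk}x_jx_k$, and $H(x)=\sum_{S\subseteq[r],|S|\ge3}c_S\prod_{j\in S}x_j$, all $c$'s integers. Then $f\in\mathscr{L}$ if and only if $H$ is homogeneous of degree 3 (i.e. $c_S\equiv0\pmod 2$ whenever $|S|\ge 4$) and the following congruences hold over $\mathbb{Z}_2$: \[\sum_{i=1}^n\prod_{j\in S}a_{ij}\equiv0 \quad\text{for all } S\subseteq[r] \text{ with } 1\le|S|\le4,\] \[\sum_{i=1}^n\Big(\prod_{j\in S}a_{ij}\Big)b_i\equiv c_S \quad\text{for all } S\subseteq[r] \text{ with } 1\le|S|\le3,\] where $c_{\{j\}}=c_j$, $c_{\{j,k\}}=c_{jk}$, $c_{\{j,k,\ell\}}=c_{jk\ell}$.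
   Context: $\chi_{\mathrm{supp}(f)}$ is the 0-1 indicator of $\mathrm{supp}(f)=\{x:f(x)\ne0\}$. In the exponent of $\alpha$ the variables $x_j\in\{0,1\}$ are integers and the expression is evaluated in $\mathbb{Z}$ (equivalently mod 8); the coefficients $c_j$ (mod 8), $c_{jk}$ (mod 4), $c_S$ for $|S|\ge3$ (mod 2) are uniquely determined by $f$. The class $\mathscr{A}$: $g\in\mathscr{A}$ iff $\mathrm{supp}(g)$ is an affine subspace of $\mathbb{Z}_2^n$ and, for free variables $x_1,\dots,x_r$ of it, $g=\mu\, i^{L'(x_1,\dots,x_r)+2Q'(x_1,\dots,x_r)}$ on the support, with $\mu\neq0$, $L'$ linear with integer coefficients, $Q'$ multilinear with integer coefficients and all monomials of degree 2 (or $g\equiv0$). $f$ of arity $n$ belongs to $\mathscr{L}$ iff for every $\sigma=s_1\cdots s_n\in\mathrm{supp}(f)$ the function $x\mapsto\alpha^{\sum_i s_ix_i}f(x)$ (integer sum) belongs to $\mathscr{A}$. -}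

module Defs where

open import Data.Bool using (Bool; true; false; if_then_else_; _xor_)
import Data.Bool.Properties as Bool
open import Data.Fin using (Fin; _<?_)
open import Data.Fin.Subset using (Subset; inside; outside; ⁅_⁆; _∪_; ∣_∣)
open import Data.Integer using (ℤ; +_; -[1+_])
import Data.Integer as ℤ
import Data.Integer.Divisibility as ℤ
import Data.Integer.Properties as ℤ
open import Data.Nat using (ℕ; zero; suc)
import Data.Nat as ℕ
import Data.Nat.Coprimality as ℕ
import Data.Nat.Properties as ℕ
open import Data.Product using (∃; ∃!; _×_; _,_; proj₁; proj₂)
open import Data.Rational using (ℚ; mkℚ; 0ℚ; 1ℚ; ½)
import Data.Rational as ℚ
import Data.Rational.Properties as ℚ
open import Data.Rational.Solver using (module +-*-Solver)
import Data.Rational.Unnormalised as ℚᵘ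
import Data.Rational.Unnormalised.Properties as ℚᵘ
open import Data.Sum using (_⊎_; inj₁; inj₂)
open import Data.Vec using (Vec; []; _∷_; lookup; tabulate; replicate; zipWith)
open import Data.Vec.Properties using (≡-dec)
open import Function using (_∘_)
open import Relation.Binary.PropositionalEquality using (_≡_; refl; sym; trans; cong; cong₂; subst)
open import Relation.Nullary using (¬_; Dec; yes; no; does)
open import Relation.Unary using (Pred; Decidable)
open import Level using (0ℓ)

open import Algebra.Properties.Monoid.Sum ℤ.+-0-monoid using (sum)
open import Algebra.Properties.Monoid.Sum ℤ.*-1-monoid using () renaming (sum to product)

-- Real numbers: Cauchy sequences of rationals, compared by the setoid
-- equality _≈ᴿ_ (two sequences are equal iff their difference tends to 0).

IsCauchy : (ℕ → ℚ) → Set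
IsCauchy x = ∀ ε → 0ℚ ℚ.< ε →
  ∃ λ N → ∀ m n → N ℕ.≤ m → N ℕ.≤ n → ℚ.∣ x m ℚ.- x n ∣ ℚ.≤ ε

record ℝ : Set where
  constructor mkℝ
  field
    seq    : ℕ → ℚ
    cauchy : IsCauchy seq

open ℝ public

infix 4 _≈ᴿ_

_≈ᴿ_ : ℝ → ℝ → Set
x ≈ᴿ y = ∀ ε → 0ℚ ℚ.< ε →
  ∃ λ N → ∀ n → N ℕ.≤ n → ℚ.∣ seq x n ℚ.- seq y n ∣ ℚ.≤ ε

module CauchyLemmas where
  half : ∀ {ε} → 0ℚ ℚ.< ε → 0ℚ ℚ.< ½ ℚ.* ε
  half {ε} 0<ε = subst (ℚ._< ½ ℚ.* ε) (ℚ.*-zeroʳ ½) (ℚ.*-monoʳ-<-pos ½ 0<ε)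

  halves : ∀ ε → ½ ℚ.* ε ℚ.+ ½ ℚ.* ε ≡ ε
  halves ε = trans (sym (ℚ.*-distribʳ-+ ε ½ ½)) (ℚ.*-identityˡ ε)

  *-mono-≤-nonNeg : ∀ {p q r s} → 0ℚ ℚ.≤ q → 0ℚ ℚ.≤ r → p ℚ.≤ q → r ℚ.≤ s → p ℚ.* r ℚ.≤ q ℚ.* s
  *-mono-≤-nonNeg {p} {q} {r} {s} 0≤q 0≤r p≤q r≤s = ℚ.≤-trans
    (ℚ.*-monoʳ-≤-nonNeg r {{ℚ.nonNegative 0≤r}} p≤q)
    (ℚ.*-monoˡ-≤-nonNeg q {{ℚ.nonNegative 0≤q}} r≤s)

  const-cauchy : ∀ q → IsCauchy (λ _ → q)
  const-cauchy q ε 0<ε = 0 , λ _ _ _ _ →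
    subst (λ d → ℚ.∣ d ∣ ℚ.≤ ε) (sym (ℚ.+-inverseʳ q)) (ℚ.<⇒≤ 0<ε)

  +-cauchy : ∀ {x y} → IsCauchy x → IsCauchy y → IsCauchy (λ n → x n ℚ.+ y n)
  +-cauchy {x} {y} cx cy ε 0<ε with cx (½ ℚ.* ε) (half 0<ε) | cy (½ ℚ.* ε) (half 0<ε)
  ... | M , p | N , q = M ℕ.⊔ N , λ m n m≥ n≥ → begin
      ℚ.∣ (x m ℚ.+ y m) ℚ.- (x n ℚ.+ y n) ∣
        ≡⟨ cong ℚ.∣_∣ (regroup (x m) (y m) (x n) (y n)) ⟩
      ℚ.∣ (x m ℚ.- x n) ℚ.+ (y m ℚ.- y n) ∣
        ≤⟨ ℚ.∣p+q∣≤∣p∣+∣q∣ (x m ℚ.- x n) (y m ℚ.- y n) ⟩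
      ℚ.∣ x m ℚ.- x n ∣ ℚ.+ ℚ.∣ y m ℚ.- y n ∣
        ≤⟨ ℚ.+-mono-≤ (p m n (ℕ.m⊔n≤o⇒m≤o M N m≥) (ℕ.m⊔n≤o⇒m≤o M N n≥))
                      (q m n (ℕ.m⊔n≤o⇒n≤o M N m≥) (ℕ.m⊔n≤o⇒n≤o M N n≥)) ⟩
      ½ ℚ.* ε ℚ.+ ½ ℚ.* ε
        ≡⟨ halves ε ⟩
      ε ∎
    where
    open ℚ.≤-Reasoning
    open +-*-Solver
    regroup : ∀ a b c d → (a ℚ.+ b) ℚ.- (c ℚ.+ d) ≡ (a ℚ.- c) ℚ.+ (b ℚ.- d)
    regroup = solve 4 (λ a b c d → (a :+ b) :- (c :+ d) := (a :- c) :+ (b :- d)) refl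

  neg-cauchy : ∀ {x} → IsCauchy x → IsCauchy (λ n → ℚ.- x n)
  neg-cauchy {x} cx ε 0<ε with cx ε 0<ε
  ... | N , p = N , λ m n m≥ n≥ → subst (ℚ._≤ ε)
      (trans (sym (ℚ.∣-p∣≡∣p∣ (x m ℚ.- x n))) (cong ℚ.∣_∣ (ℚ.neg-distrib-+ (x m) (ℚ.- x n))))
      (p m n m≥ n≥)

  eventually-bounded : ∀ {x} → IsCauchy x →
    ∃ λ N → ∃ λ B → 0ℚ ℚ.< B × (∀ n → N ℕ.≤ n → ℚ.∣ x n ∣ ℚ.≤ B)
  eventually-bounded {x} cx with cx 1ℚ (ℚ.positive⁻¹ 1ℚ)
  ... | N , p = N , 1ℚ ℚ.+ ℚ.∣ x N ∣ ,
      ℚ.+-mono-<-≤ (ℚ.positive⁻¹ 1ℚ) (ℚ.0≤∣p∣ (x N)) , λ n n≥ → begin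
        ℚ.∣ x n ∣                          ≡⟨ cong ℚ.∣_∣ (split (x n) (x N)) ⟩
        ℚ.∣ (x n ℚ.- x N) ℚ.+ x N ∣        ≤⟨ ℚ.∣p+q∣≤∣p∣+∣q∣ (x n ℚ.- x N) (x N) ⟩
        ℚ.∣ x n ℚ.- x N ∣ ℚ.+ ℚ.∣ x N ∣    ≤⟨ ℚ.+-monoˡ-≤ ℚ.∣ x N ∣ (p n N n≥ ℕ.≤-refl) ⟩
        1ℚ ℚ.+ ℚ.∣ x N ∣                   ∎
    where
    open ℚ.≤-Reasoning
    open +-*-Solver
    split : ∀ a b → a ≡ (a ℚ.- b) ℚ.+ b
    split = solve 2 (λ a b → a := (a :- b) :+ b) refl

  divide : ∀ {ε B} → 0ℚ ℚ.< ε → 0ℚ ℚ.< B → ∃ λ δ → 0ℚ ℚ.< δ × B ℚ.* δ ≡ ε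
  divide {ε} {B} 0<ε 0<B = r ℚ.* ε ,
      subst (ℚ._< r ℚ.* ε) (ℚ.*-zeroʳ r) (ℚ.*-monoʳ-<-pos r 0<ε) ,
      trans (sym (ℚ.*-assoc B r ε)) (trans (cong (ℚ._* ε) (ℚ.*-inverseʳ B)) (ℚ.*-identityˡ ε))
    where
    instance
      B-positive : ℚ.Positive B
      B-positive = ℚ.positive 0<B
      B-nonZero : ℚ.NonZero B
      B-nonZero = ℚ.pos⇒nonZero B
    r : ℚ
    r = ℚ.1/ B
    instance
      r-positive : ℚ.Positive r
      r-positive = ℚ.1/pos⇒pos B

  *-diff : ∀ a b c d → a ℚ.* b ℚ.- c ℚ.* d ≡ a ℚ.* (b ℚ.- d) ℚ.+ d ℚ.* (a ℚ.- c)
  *-diff = solve 4 (λ a b c d → a :* b :- c :* d := a :* (b :- d) :+ d :* (a :- c)) refl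
    where open +-*-Solver

  *-close : ∀ {a b c d A B δ η} → 0ℚ ℚ.≤ A → 0ℚ ℚ.≤ B →
            ℚ.∣ a ∣ ℚ.≤ A → ℚ.∣ d ∣ ℚ.≤ B → ℚ.∣ b ℚ.- d ∣ ℚ.≤ δ → ℚ.∣ a ℚ.- c ∣ ℚ.≤ η →
            ℚ.∣ a ℚ.* b ℚ.- c ℚ.* d ∣ ℚ.≤ A ℚ.* δ ℚ.+ B ℚ.* η
  *-close {a} {b} {c} {d} {A} {B} {δ} {η} 0≤A 0≤B a≤A d≤B b-d≤δ a-c≤η = begin
    ℚ.∣ a ℚ.* b ℚ.- c ℚ.* d ∣
      ≡⟨ cong ℚ.∣_∣ (*-diff a b c d) ⟩
    ℚ.∣ a ℚ.* (b ℚ.- d) ℚ.+ d ℚ.* (a ℚ.- c) ∣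
      ≤⟨ ℚ.∣p+q∣≤∣p∣+∣q∣ (a ℚ.* (b ℚ.- d)) (d ℚ.* (a ℚ.- c)) ⟩
    ℚ.∣ a ℚ.* (b ℚ.- d) ∣ ℚ.+ ℚ.∣ d ℚ.* (a ℚ.- c) ∣
      ≡⟨ cong₂ ℚ._+_ (ℚ.∣p*q∣≡∣p∣*∣q∣ a (b ℚ.- d)) (ℚ.∣p*q∣≡∣p∣*∣q∣ d (a ℚ.- c)) ⟩
    ℚ.∣ a ∣ ℚ.* ℚ.∣ b ℚ.- d ∣ ℚ.+ ℚ.∣ d ∣ ℚ.* ℚ.∣ a ℚ.- c ∣
      ≤⟨ ℚ.+-mono-≤ (*-mono-≤-nonNeg 0≤A (ℚ.0≤∣p∣ (b ℚ.- d)) a≤A b-d≤δ)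
                    (*-mono-≤-nonNeg 0≤B (ℚ.0≤∣p∣ (a ℚ.- c)) d≤B a-c≤η) ⟩
    A ℚ.* δ ℚ.+ B ℚ.* η ∎
    where open ℚ.≤-Reasoning

  *-cauchy : ∀ {x y} → IsCauchy x → IsCauchy y → IsCauchy (λ n → x n ℚ.* y n)
  *-cauchy {x} {y} cx cy ε 0<ε =
    let K , A , 0<A , x≤A = eventually-bounded {x} cx
        L , B , 0<B , y≤B = eventually-bounded {y} cy
        δ , 0<δ , Aδ      = divide (half 0<ε) 0<A
        η , 0<η , Bη      = divide (half 0<ε) 0<B
        M , p             = cx η 0<η
        N , q             = cy δ 0<δ
    in (K ℕ.⊔ L) ℕ.⊔ (M ℕ.⊔ N) , λ m n m≥ n≥ →
      let m≥₁ = ℕ.m⊔n≤o⇒m≤o (K ℕ.⊔ L) (M ℕ.⊔ N) m≥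
          n≥₁ = ℕ.m⊔n≤o⇒m≤o (K ℕ.⊔ L) (M ℕ.⊔ N) n≥
          m≥₂ = ℕ.m⊔n≤o⇒n≤o (K ℕ.⊔ L) (M ℕ.⊔ N) m≥
          n≥₂ = ℕ.m⊔n≤o⇒n≤o (K ℕ.⊔ L) (M ℕ.⊔ N) n≥
      in subst (ℚ.∣ x m ℚ.* y m ℚ.- x n ℚ.* y n ∣ ℚ.≤_)
           (trans (cong₂ ℚ._+_ Aδ Bη) (halves ε))
           (*-close {x m} {y m} {x n} {y n} {A} {B} {δ} {η} (ℚ.<⇒≤ 0<A) (ℚ.<⇒≤ 0<B)
             (x≤A m (ℕ.m⊔n≤o⇒m≤o K L m≥₁)) (y≤B n (ℕ.m⊔n≤o⇒n≤o K L n≥₁))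
             (q m n (ℕ.m⊔n≤o⇒n≤o M N m≥₂) (ℕ.m⊔n≤o⇒n≤o M N n≥₂))
             (p m n (ℕ.m⊔n≤o⇒m≤o M N m≥₂) (ℕ.m⊔n≤o⇒m≤o M N n≥₂)))

open CauchyLemmas

infix  8 -ᴿ_
infixl 7 _*ᴿ_
infixl 6 _+ᴿ_

fromℚ : ℚ → ℝ
fromℚ q = mkℝ (λ _ → q) (const-cauchy q)

0ᴿ 1ᴿ : ℝ
0ᴿ = fromℚ 0ℚ
1ᴿ = fromℚ 1ℚ

_+ᴿ_ : ℝ → ℝ → ℝ
x +ᴿ y = mkℝ (λ n → seq x n ℚ.+ seq y n) (+-cauchy {seq x} {seq y} (cauchy x) (cauchy y))

-ᴿ_ : ℝ → ℝ
-ᴿ x = mkℝ (λ n → ℚ.- seq x n) (neg-cauchy {seq x} (cauchy x))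

_*ᴿ_ : ℝ → ℝ → ℝ
x *ᴿ y = mkℝ (λ n → seq x n ℚ.* seq y n) (*-cauchy {seq x} {seq y} (cauchy x) (cauchy y))

-- √½ by bisection: bisect k ≤ √½ ≤ bisect k + width k at every stage k.

width : ℕ → ℚ
width zero    = 1ℚ
width (suc k) = ½ ℚ.* width k

bisect : ℕ → ℚ
bisect zero    = 0ℚ
bisect (suc k) =
  let mid = bisect k ℚ.+ width (suc k)
  in if does (mid ℚ.* mid ℚ.≤? ½) then mid else bisect k

module BisectionLemmas where
  recip : ℕ → ℚ
  recip k = mkℚ (+ 1) k (ℕ.1-coprimeTo (suc k))

  width≤recip : ∀ k → width k ℚ.≤ recip k
  width≤recip zero    = ℚ.≤-refl
  width≤recip (suc k) = ℚ.≤-trans (ℚ.*-monoˡ-≤-nonNeg ½ (width≤recip k))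
    (ℚ.toℚᵘ-cancel-≤ (ℚᵘ.≤-respˡ-≃ (ℚᵘ.≃-sym (ℚ.toℚᵘ-homo-* ½ (recip k)))
      (ℚᵘ.*≤* (ℤ.+≤+ (ℕ.s≤s bound)))))
    where
    open ℕ.≤-Reasoning
    bound : suc k ℕ.+ 0 ℕ.≤ k ℕ.+ suc (k ℕ.+ 0) ℕ.+ 0
    bound = begin
      suc k ℕ.+ 0                   ≡⟨ ℕ.+-identityʳ (suc k) ⟩
      suc k                         ≤⟨ ℕ.s≤s (ℕ.m≤m+n k (k ℕ.+ 0)) ⟩
      suc (k ℕ.+ (k ℕ.+ 0))         ≡⟨ ℕ.+-suc k (k ℕ.+ 0) ⟨
      k ℕ.+ suc (k ℕ.+ 0)           ≡⟨ ℕ.+-identityʳ (k ℕ.+ suc (k ℕ.+ 0)) ⟨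
      k ℕ.+ suc (k ℕ.+ 0) ℕ.+ 0     ∎

  width-small : ∀ ε → 0ℚ ℚ.< ε → ∃ λ N → width N ℚ.≤ ε
  width-small (mkℚ (+ zero) _ _) (ℚ.*<* (ℤ.+<+ ()))
  width-small (mkℚ (+ suc p) d c) _ = d , ℚ.≤-trans (width≤recip d)
    (ℚ.*≤* (ℤ.*-monoʳ-≤-nonNeg (+ suc d) {+ 1} {+ suc p} (ℤ.+≤+ (ℕ.s≤s ℕ.z≤n))))
  width-small (mkℚ -[1+ _ ] _ _) (ℚ.*<* ())

  width-split : ∀ k → width (suc k) ℚ.+ width (suc k) ≡ width k
  width-split k = halves (width k)

  0≤width : ∀ k → 0ℚ ℚ.≤ width k
  0≤width zero    = ℚ.nonNegative⁻¹ 1ℚ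
  0≤width (suc k) = subst (ℚ._≤ width (suc k)) (ℚ.*-zeroʳ ½) (ℚ.*-monoˡ-≤-nonNeg ½ (0≤width k))

  p≤p+q : ∀ p {q} → 0ℚ ℚ.≤ q → p ℚ.≤ p ℚ.+ q
  p≤p+q p {q} 0≤q = subst (ℚ._≤ p ℚ.+ q) (ℚ.+-identityʳ p) (ℚ.+-monoʳ-≤ p 0≤q)

  nested-step : ∀ k → bisect k ℚ.≤ bisect (suc k) ×
                      bisect (suc k) ℚ.+ width (suc k) ℚ.≤ bisect k ℚ.+ width k
  nested-step k with does ((bisect k ℚ.+ width (suc k)) ℚ.* (bisect k ℚ.+ width (suc k)) ℚ.≤? ½)
  ... | true  = p≤p+q (bisect k) (0≤width (suc k)) ,
                ℚ.≤-reflexive (trans (ℚ.+-assoc (bisect k) (width (suc k)) (width (suc k)))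
                                     (cong (bisect k ℚ.+_) (width-split k)))
  ... | false = ℚ.≤-refl , ℚ.+-monoʳ-≤ (bisect k)
                  (subst (width (suc k) ℚ.≤_) (width-split k) (p≤p+q (width (suc k)) (0≤width (suc k))))

  nested : ∀ {N n} → N ℕ.≤′ n → bisect N ℚ.≤ bisect n ×
                                bisect n ℚ.+ width n ℚ.≤ bisect N ℚ.+ width N
  nested ℕ.≤′-refl       = ℚ.≤-refl , ℚ.≤-refl
  nested (ℕ.≤′-step {n} N≤n) with nested N≤n | nested-step n
  ... | l , u | l′ , u′ = ℚ.≤-trans l l′ , ℚ.≤-trans u′ u

  -- two points of the interval [a, a + w] differ by at most w
  close : ∀ {a w p q} → a ℚ.≤ p → p ℚ.≤ a ℚ.+ w → a ℚ.≤ q → q ℚ.≤ a ℚ.+ w → ℚ.∣ p ℚ.- q ∣ ℚ.≤ w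
  close {a} {w} {p} {q} a≤p p≤a+w a≤q q≤a+w with ℚ.∣p∣≡p∨∣p∣≡-p (p ℚ.- q)
  ... | inj₁ eq = subst (ℚ._≤ w) (sym eq)
                    (subst (p ℚ.- q ℚ.≤_) (cancel a w) (ℚ.+-mono-≤ p≤a+w (ℚ.neg-antimono-≤ a≤q)))
    where
    open +-*-Solver
    cancel : ∀ a w → a ℚ.+ w ℚ.- a ≡ w
    cancel = solve 2 (λ a w → a :+ w :- a := w) refl
  ... | inj₂ eq = subst (ℚ._≤ w) (sym (trans eq (flip p q)))
                    (subst (q ℚ.- p ℚ.≤_) (cancel a w) (ℚ.+-mono-≤ q≤a+w (ℚ.neg-antimono-≤ a≤p)))
    where
    open +-*-Solver
    cancel : ∀ a w → a ℚ.+ w ℚ.- a ≡ w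
    cancel = solve 2 (λ a w → a :+ w :- a := w) refl
    flip : ∀ p q → ℚ.- (p ℚ.- q) ≡ q ℚ.- p
    flip = solve 2 (λ p q → :- (p :- q) := q :- p) refl

  bisect-cauchy : IsCauchy bisect
  bisect-cauchy ε 0<ε with width-small ε 0<ε
  ... | N , w≤ε = N , λ m n m≥ n≥ →
      ℚ.≤-trans (close (lower m≥) (upper m≥) (lower n≥) (upper n≥)) w≤ε
    where
    lower : ∀ {k} → N ℕ.≤ k → bisect N ℚ.≤ bisect k
    lower N≤k = proj₁ (nested (ℕ.≤⇒≤′ N≤k))
    upper : ∀ {k} → N ℕ.≤ k → bisect k ℚ.≤ bisect N ℚ.+ width N
    upper {k} N≤k = ℚ.≤-trans (p≤p+q (bisect k) (0≤width k)) (proj₂ (nested (ℕ.≤⇒≤′ N≤k)))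

  width-mono : ∀ {N n} → N ℕ.≤′ n → width n ℚ.≤ width N
  width-mono ℕ.≤′-refl           = ℚ.≤-refl
  width-mono (ℕ.≤′-step {n} N≤n) = ℚ.≤-trans
    (subst (width (suc n) ℚ.≤_) (width-split n) (p≤p+q (width (suc n)) (0≤width (suc n))))
    (width-mono N≤n)

  bracket-step : ∀ {l w} (mid²≤½? : Dec ((l ℚ.+ w) ℚ.* (l ℚ.+ w) ℚ.≤ ½)) →
    l ℚ.* l ℚ.≤ ½ → ½ ℚ.≤ (l ℚ.+ (w ℚ.+ w)) ℚ.* (l ℚ.+ (w ℚ.+ w)) →
    let l′ = if does mid²≤½? then l ℚ.+ w else l
    in l′ ℚ.* l′ ℚ.≤ ½ × ½ ℚ.≤ (l′ ℚ.+ w) ℚ.* (l′ ℚ.+ w)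
  bracket-step {l} {w} (yes mid²≤½) _ ½≤u² =
    mid²≤½ , subst (λ u → ½ ℚ.≤ u ℚ.* u) (sym (ℚ.+-assoc l w w)) ½≤u²
  bracket-step         (no  mid²≰½) l²≤½ _ = l²≤½ , ℚ.<⇒≤ (ℚ.≰⇒> mid²≰½)

  bracket : ∀ k → bisect k ℚ.* bisect k ℚ.≤ ½ ×
                  ½ ℚ.≤ (bisect k ℚ.+ width k) ℚ.* (bisect k ℚ.+ width k)
  bracket zero    = ℚ.≤ᵇ⇒≤ _ , ℚ.≤ᵇ⇒≤ _
  bracket (suc k) = bracket-step {bisect k} {width (suc k)} (_ ℚ.≤? _)
    (proj₁ (bracket k))
    (subst (λ w → ½ ℚ.≤ (bisect k ℚ.+ w) ℚ.* (bisect k ℚ.+ w)) (sym (width-split k)) (proj₂ (bracket k)))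

  square-upper : ∀ {l w} → 0ℚ ℚ.≤ w → l ℚ.+ w ℚ.≤ 1ℚ →
                 (l ℚ.+ w) ℚ.* (l ℚ.+ w) ℚ.≤ l ℚ.* l ℚ.+ w ℚ.* (1ℚ ℚ.+ 1ℚ)
  square-upper {l} {w} 0≤w u≤1 = subst (ℚ._≤ l ℚ.* l ℚ.+ w ℚ.* (1ℚ ℚ.+ 1ℚ)) (sym (expand l w))
    (ℚ.+-monoʳ-≤ (l ℚ.* l) (ℚ.*-monoˡ-≤-nonNeg w {{ℚ.nonNegative 0≤w}}
      (ℚ.+-mono-≤ (ℚ.≤-trans (p≤p+q l 0≤w) u≤1) u≤1)))
    where
    open +-*-Solver
    expand : ∀ l w → (l ℚ.+ w) ℚ.* (l ℚ.+ w) ≡ l ℚ.* l ℚ.+ w ℚ.* (l ℚ.+ (l ℚ.+ w))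
    expand = solve 2 (λ l w → (l :+ w) :* (l :+ w) := l :* l :+ w :* (l :+ (l :+ w))) refl

  square-error : ∀ k → ℚ.∣ bisect k ℚ.* bisect k ℚ.- ½ ∣ ℚ.≤ width k ℚ.* (1ℚ ℚ.+ 1ℚ)
  square-error k = close {l²} {e} {l²} {½} ℚ.≤-refl (p≤p+q l² 0≤e) (proj₁ (bracket k))
    (ℚ.≤-trans (proj₂ (bracket k))
      (square-upper {bisect k} {width k} (0≤width k) (proj₂ (nested (ℕ.z≤′n {k})))))
    where
    l² e : ℚ
    l² = bisect k ℚ.* bisect k
    e  = width k ℚ.* (1ℚ ℚ.+ 1ℚ)
    0≤e : 0ℚ ℚ.≤ e
    0≤e = ℚ.*-monoʳ-≤-nonNeg (1ℚ ℚ.+ 1ℚ) (0≤width k)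

open BisectionLemmas

√½ : ℝ
√½ = mkℝ bisect bisect-cauchy

√½-square : √½ *ᴿ √½ ≈ᴿ fromℚ ½
√½-square ε 0<ε =
  let N , w≤½ε = width-small (½ ℚ.* ε) (half 0<ε)
  in N , λ n N≤n → ℚ.≤-trans (square-error n)
       (subst (width n ℚ.* (1ℚ ℚ.+ 1ℚ) ℚ.≤_) (double ε)
         (ℚ.*-monoʳ-≤-nonNeg (1ℚ ℚ.+ 1ℚ) (ℚ.≤-trans (width-mono (ℕ.≤⇒≤′ N≤n)) w≤½ε)))
  where
  double : ∀ ε → ½ ℚ.* ε ℚ.* (1ℚ ℚ.+ 1ℚ) ≡ ε
  double ε = trans (ℚ.*-distribˡ-+ (½ ℚ.* ε) 1ℚ 1ℚ)
    (trans (cong₂ ℚ._+_ (ℚ.*-identityʳ (½ ℚ.* ε)) (ℚ.*-identityʳ (½ ℚ.* ε))) (halves ε))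

record ℂ : Set where
  constructor _+i_
  field
    re im : ℝ

open ℂ public

infix 4 _≈_ _≉_
infixl 7 _·_
infixr 8 _^ℕ_ _^_

_≈_ _≉_ : ℂ → ℂ → Set
z ≈ w = re z ≈ᴿ re w × im z ≈ᴿ im w
z ≉ w = ¬ z ≈ w

0ᶜ 1ᶜ 𝕚 α : ℂ
0ᶜ = 0ᴿ +i 0ᴿ
1ᶜ = 1ᴿ +i 0ᴿ
𝕚  = 0ᴿ +i 1ᴿ
-- e^{πi/4} = cos (π/4) + i sin (π/4)
α  = √½ +i √½

_·_ : ℂ → ℂ → ℂ
z · w = (re z *ᴿ re w +ᴿ -ᴿ (im z *ᴿ im w)) +i (re z *ᴿ im w +ᴿ im z *ᴿ re w)

conj : ℂ → ℂ
conj z = re z +i (-ᴿ im z)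

_^ℕ_ : ℂ → ℕ → ℂ
z ^ℕ zero  = 1ᶜ
z ^ℕ suc n = z · z ^ℕ n

-- Integer powers of a complex number of modulus 1, for which z⁻¹ = conj z.
-- Only α and 𝕚 are ever used as base.
_^_ : ℂ → ℤ → ℂ
z ^ (+ n)    = z ^ℕ n
z ^ -[1+ n ] = conj z ^ℕ suc n

-- {0,1}ⁿ, also read as ℤ₂ⁿ with addition _⊕_
Bits : ℕ → Set
Bits = Vec Bool

bit : Bool → ℤ
bit false = + 0
bit true  = + 1

infixl 6 _⊕_

_⊕_ : ∀ {n} → Bits n → Bits n → Bits n
_⊕_ = zipWith _xor_

infix 4 _≡_[mod_]

_≡_[mod_] : ℤ → ℤ → ℕ → Set
a ≡ b [mod m ] = + m ℤ.∣ a ℤ.- b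

Supp : ∀ {n} → (Bits n → ℂ) → Pred (Bits n) 0ℓ
Supp f x = f x ≉ 0ᶜ

IsLinearSubspace : ∀ {n} → Pred (Bits n) 0ℓ → Set
IsLinearSubspace {n} V = V (replicate n false) × (∀ x y → V x → V y → V (x ⊕ y))

-- a translate v₀ + V of a linear subspace V of ℤ₂ⁿ
IsAffineSubspace : ∀ {n} → Pred (Bits n) 0ℓ → Set
IsAffineSubspace P = ∃ λ v₀ → IsLinearSubspace (λ d → P (v₀ ⊕ d))

restrict : ∀ {n r} → (Fin r → Fin n) → Bits n → Bits r
restrict ι x = tabulate (lookup x ∘ ι)

-- The variables x_{ι 0}, …, x_{ι (r-1)} are free variables of P: they take
-- every value in {0,1}ʳ and determine the point of P. For an affine subspace
-- this makes r its dimension.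
FreeVariables : ∀ {n r} → Pred (Bits n) 0ℓ → (Fin r → Fin n) → Set
FreeVariables P ι = ∀ y → ∃! _≡_ λ x → P x × restrict ι x ≡ y

free⇒dec : ∀ {n r} {P : Pred (Bits n) 0ℓ} {ι : Fin r → Fin n} →
           FreeVariables P ι → Decidable P
free⇒dec {ι = ι} free x with free (restrict ι x)
... | x′ , (Px′ , _) , unique with ≡-dec Bool._≟_ x′ x
... | yes refl = yes Px′
... | no x′≢x  = no λ Px → x′≢x (unique (Px , refl))

-- 0-1 indicator function of P
χ : ∀ {n} {P : Pred (Bits n) 0ℓ} → Decidable P → Bits n → ℂ
χ P? x = if does (P? x) then 1ᶜ else 0ᶜ

linear : ∀ {r} → (Fin r → ℤ) → Bits r → ℤ
linear c x = sum λ j → c j ℤ.* bit (lookup x j)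

-- Σ_{j<k} c_{jk} x_j x_k ; the values c j k with j ≥ k are not used
quadratic : ∀ {r} → (Fin r → Fin r → ℤ) → Bits r → ℤ
quadratic c x = sum λ j → sum λ k →
  if does (j <? k) then c j k ℤ.* (bit (lookup x j) ℤ.* bit (lookup x k)) else + 0

∑⊆ : ∀ r → (Subset r → ℤ) → ℤ
∑⊆ zero    F = F []
∑⊆ (suc r) F = ∑⊆ r (λ S → F (outside ∷ S)) ℤ.+ ∑⊆ r (λ S → F (inside ∷ S))

∏∈ : ∀ {r} → Subset r → (Fin r → ℤ) → ℤ
∏∈ S v = product λ j → if lookup S j then v j else + 1

-- Σ_{|S|≥3} c_S ∏_{j∈S} x_j
higher : ∀ {r} → (Subset r → ℤ) → Bits r → ℤ
higher {r} c x = ∑⊆ r λ S →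
  if does (3 ℕ.≤? ∣ S ∣) then c S ℤ.* ∏∈ S (bit ∘ lookup x) else + 0

-- L + 2Q + 4H for the coefficients c_j = c ⁅ j ⁆, c_{jk} = c (⁅ j ⁆ ∪ ⁅ k ⁆)
-- and c_S = c S for |S| ≥ 3; the value c ⊥ is not used.
exponent : ∀ {r} → (Subset r → ℤ) → Bits r → ℤ
exponent c x = linear (λ j → c ⁅ j ⁆) x
         ℤ.+ + 2 ℤ.* quadratic (λ j k → c (⁅ j ⁆ ∪ ⁅ k ⁆)) x
         ℤ.+ + 4 ℤ.* higher c x

record IsAffineForm {n} (g : Bits n → ℂ) : Set where
  field
    supp-affine : IsAffineSubspace (Supp g)
    {dim}       : ℕ
    ι           : Fin dim → Fin n
    free        : FreeVariables (Supp g) ι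
    μ           : ℂ
    μ≉0         : μ ≉ 0ᶜ
    L′          : Fin dim → ℤ
    Q′          : Fin dim → Fin dim → ℤ
    form        : ∀ x → Supp g x →
                  g x ≈ μ · 𝕚 ^ (linear L′ (restrict ι x) ℤ.+ + 2 ℤ.* quadratic Q′ (restrict ι x))

_∈𝒜 : ∀ {n} → (Bits n → ℂ) → Set
g ∈𝒜 = (∀ x → g x ≈ 0ᶜ) ⊎ IsAffineForm g

_∈ℒ : ∀ {n} → (Bits n → ℂ) → Set
f ∈ℒ = ∀ σ → Supp f σ →
  (λ x → α ^ sum (λ i → bit (lookup σ i) ℤ.* bit (lookup x i)) · f x) ∈𝒜

{-# OPTIONS --safe #-}
module Submission where

-- For σ in the support of f, write α^{Σ σᵢxᵢ} f(x) = λ α^{e(y)} with y the free variables of x.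
-- Since 1 − 2·bit (b ⊕ a·y) = (1 − 2b) ∏ⱼ (1 − 2aⱼyⱼ), a bit of an affine form over ℤ₂ equals,
-- over ℤ, a constant plus L + 2Q + 4H, where the coefficient c_S is an odd multiple of ∏_{j∈S} aⱼ
-- for 1 ≤ |S| ≤ 3 and an even one for |S| ≥ 4. Hence e = constant + exponent d with
-- d_S ≡ c_S + Σᵢ σᵢ ∏_{j∈S} aᵢⱼ (mod 2) for 1 ≤ |S| ≤ 3 and d_S ≡ c_S for |S| ≥ 4.
-- The twisted function is in 𝒜 iff all d_S with S ≠ ∅ are even: if they are, halve them; conversely
-- 2uv = u + v − (u ⊕ v) writes i^{L′+2Q′}, in whatever free variables, as α^{2(constant + exponent d′)},
-- and multilinear coefficients are unique modulo 8. Letting σ run over the support, with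
-- σᵢ ≡ Σₘ aᵢₘsₘ + bᵢ, the evenness of all d_S becomes the stated congruences.

open import Defs
open import Algebra.Bundles using (CommutativeMonoid)
open import Data.Bool using (Bool; true; false; if_then_else_; _xor_; _∧_)
import Data.Bool.Solver as Bool
open import Data.Fin using (Fin; zero; suc; inject≤; _≟_; _<?_)
open import Data.Fin.Subset using (Subset; inside; outside; ⊥; ⁅_⁆; _∪_; ∣_∣)
open import Data.Fin.Subset.Properties using (∪-identityˡ)
open import Data.Integer using (ℤ; +_; -[1+_]; _+_; _*_; -_)
open import Data.Integer.Divisibility.Signed using (divides; ∣ᵤ⇒∣; ∣⇒∣ᵤ)
open import Data.Integer.DivMod using (_%ℕ_; _/ℕ_; n%ℕd<d; a≡a%ℕn+[a/ℕn]*n)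
open import Data.Integer.Properties using (+-0-monoid)
import Data.Integer.Properties as ℤ
open import Data.Integer.Tactic.RingSolver using (solve-∀)
open import Data.Nat using (ℕ; zero; suc; z≤n; s≤s; _≤_)
import Data.Nat as ℕ
open import Data.Nat.Divisibility using (∣1⇒≡1)
import Data.Nat.Properties as ℕ
open import Data.Product using (∃; _×_; _,_; proj₁; proj₂)
open import Data.Rational using (ℚ; 0ℚ; 1ℚ; ½)
import Data.Rational as ℚ
import Data.Rational.Properties as ℚ
import Data.Rational.Solver as ℚ
open import Data.Sum using (inj₁; inj₂)
open import Data.Vec using ([]; _∷_; lookup; _[_]≔_; replicate)
open import Data.Vec.Properties using (lookup∘tabulate)
open import Function using (_∘_; _⇔_; mk⇔)
open import Level using (0ℓ)
open import Relation.Binary.Bundles using (Setoid)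
open import Relation.Binary.PropositionalEquality using (_≡_; refl; sym; trans; cong; cong₂; subst; subst₂; module ≡-Reasoning)
open import Relation.Nullary using (¬_; does; yes; no; contradiction)
open import Relation.Unary using (Pred; Decidable)
open import Algebra.Properties.CommutativeSemigroup ℤ.*-commutativeSemigroup using (x∙yz≈y∙xz)
open import Algebra.Properties.CommutativeSemigroup ℤ.+-commutativeSemigroup using () renaming (interchange to +-interchange)
open import Algebra.Properties.CommutativeMonoid.Sum ℤ.+-0-commutativeMonoid using (∑-comm; ∑-distrib-+)
open import Algebra.Properties.Monoid.Sum +-0-monoid using (sum; sum-cong-≗; sum-replicate-zero)
open import Algebra.Properties.Semiring.Sum ℤ.+-*-semiring using (*-distribˡ-sum)

open CauchyLemmas using (half; halves; divide; eventually-bounded; *-diff; *-mono-≤-nonNeg)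

-- Integers and congruences

-- The hypothesis `λ₀ ≉ 0ᶜ` is a bare negation: constructively it gives no lower bound on the
-- modulus, hence no inverse. So neither λ nor μ is ever divided out. Values of the twisted function
-- are compared through the exponents m with z · α^m = z, and for z ≠ 0 these are multiples of 8,
-- because every other residue doubles to 4, where z · (-1) = z forces z = 0.
--
-- The bounds 3 and 4 in the congruences come from degrees. In a bit of an affine form, ∏_{j∈S} aⱼyⱼ
-- has coefficient 2^(k-1) up to sign, k = |S|, whereas L + 2Q + 4H gives it weight 1, 2 or 4. The
-- weight stops growing at degree 3, so from degree 4 on the quotient is even and no twist can
-- change the parity of c_S. Multiplying ∏_{j∈S} aᵢⱼ by σᵢ brings in at most one further factor aᵢₘ,
-- which turns |S| ≤ 3 into |S| ≤ 4.

ℤ-induction : ∀ {p} (P : ℤ → Set p) → P (+ 0) →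
  (∀ m → P m → P (+ 1 + m)) → (∀ m → P (+ 1 + m) → P m) → ∀ m → P m
ℤ-induction P P0 up down (+ zero)      = P0
ℤ-induction P P0 up down (+ suc n)     = up (+ n) (ℤ-induction P P0 up down (+ n))
ℤ-induction P P0 up down -[1+ zero ]   = down -[1+ zero ] P0
ℤ-induction P P0 up down -[1+ suc n ]  = down -[1+ suc n ] (ℤ-induction P P0 up down -[1+ n ])

infix 4 _≅_[_]

-- Equivalent to `_≡_[mod_]`, but with a signed quotient in the open, so that every closure property
-- reduces to a ring identity.
record _≅_[_] (a b : ℤ) (m : ℕ) : Set where
  constructor congruent
  field
    quotient : ℤ
    equation : a ≡ b + quotient * + m

≡⇒≅ : ∀ {a b m} → a ≡ b → a ≅ b [ m ]
≡⇒≅ {b = b} {m} a≡b = congruent (+ 0) (trans a≡b (sym (ℤ.+-identityʳ b)))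

≅-sym : ∀ {a b m} → a ≅ b [ m ] → b ≅ a [ m ]
≅-sym {b = b} {m} (congruent q refl) = congruent (- q) (cancel b q (+ m))
  where
  cancel : ∀ b q m → b ≡ b + q * m + - q * m
  cancel = solve-∀

≅-trans : ∀ {a b c m} → a ≅ b [ m ] → b ≅ c [ m ] → a ≅ c [ m ]
≅-trans {c = c} {m} (congruent q refl) (congruent q′ refl) = congruent (q′ + q) (collect c q q′ (+ m))
  where
  collect : ∀ c q q′ m → c + q′ * m + q * m ≡ c + (q′ + q) * m
  collect = solve-∀

+-cong-≅ : ∀ {a b c d m} → a ≅ b [ m ] → c ≅ d [ m ] → a + c ≅ b + d [ m ]
+-cong-≅ {b = b} {d = d} {m} (congruent q refl) (congruent q′ refl) = congruent (q + q′) (collect b d q q′ (+ m))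
  where
  collect : ∀ b d q q′ m → (b + q * m) + (d + q′ * m) ≡ (b + d) + (q + q′) * m
  collect = solve-∀

*-cong-≅ : ∀ {a b c d m} → a ≅ b [ m ] → c ≅ d [ m ] → a * c ≅ b * d [ m ]
*-cong-≅ {b = b} {d = d} {m} (congruent q refl) (congruent q′ refl) =
  congruent (b * q′ + q * d + q * + m * q′) (collect b d q q′ (+ m))
  where
  collect : ∀ b d q q′ m → (b + q * m) * (d + q′ * m) ≡ b * d + (b * q′ + q * d + q * m * q′) * m
  collect = solve-∀

+-congˡ-≅ : ∀ k {a b m} → a ≅ b [ m ] → k + a ≅ k + b [ m ]
+-congˡ-≅ k = +-cong-≅ (≡⇒≅ {k} refl)

*-congˡ-≅ : ∀ k {a b m} → a ≅ b [ m ] → k * a ≅ k * b [ m ]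
*-congˡ-≅ k = *-cong-≅ (≡⇒≅ {k} refl)

*-congʳ-≅ : ∀ k {a b m} → a ≅ b [ m ] → a * k ≅ b * k [ m ]
*-congʳ-≅ k a≅b = *-cong-≅ a≅b (≡⇒≅ {k} refl)

sum-cong-≅ : ∀ {n m} {s t : Fin n → ℤ} → (∀ i → s i ≅ t i [ m ]) → sum s ≅ sum t [ m ]
sum-cong-≅ {zero}  s≅t = ≡⇒≅ refl
sum-cong-≅ {suc n} s≅t = +-cong-≅ (s≅t zero) (sum-cong-≅ (s≅t ∘ suc))

≅-setoid : ℕ → Setoid 0ℓ 0ℓ
≅-setoid m = record
  { Carrier       = ℤ
  ; _≈_           = λ a b → a ≅ b [ m ]
  ; isEquivalence = record { refl = ≡⇒≅ refl ; sym = ≅-sym ; trans = ≅-trans }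
  }

mod⇒≅ : ∀ {a b m} → a ≡ b [mod m ] → a ≅ b [ m ]
mod⇒≅ {a} {b} {m} m∣a-b with ∣ᵤ⇒∣ m∣a-b
... | divides q eq = congruent q (trans (split a b) (cong (_+_ b) eq))
  where
  split : ∀ a b → a ≡ b + (a + - b)
  split = solve-∀

≅⇒mod : ∀ {a b m} → a ≅ b [ m ] → a ≡ b [mod m ]
≅⇒mod {b = b} {m} (congruent q refl) = ∣⇒∣ᵤ (divides q (cancel b (q * + m)))
  where
  cancel : ∀ b c → b + c + - b ≡ c
  cancel = solve-∀

≅-bit-injective : ∀ {p q} → bit p ≅ bit q [ 2 ] → p ≡ q
≅-bit-injective {false} {false} _  = refl
≅-bit-injective {false} {true}  eq = contradiction (∣1⇒≡1 (≅⇒mod eq)) λ ()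
≅-bit-injective {true}  {false} eq = contradiction (∣1⇒≡1 (≅⇒mod eq)) λ ()
≅-bit-injective {true}  {true}  _  = refl

≅-from-difference : ∀ {p q m} → p + - q ≅ + 0 [ m ] → p ≅ q [ m ]
≅-from-difference {p} {q} (congruent k eq) =
  congruent k (trans (split p q) (trans (cong (_+_ q) eq) (cong (_+_ q) (ℤ.+-identityˡ _))))
  where
  split : ∀ p q → p ≡ q + (p + - q)
  split = solve-∀

double-even : ∀ t → t + t ≅ + 0 [ 2 ]
double-even t = congruent t (twice t)
  where
  twice : ∀ t → t + t ≡ + 0 + t * + 2
  twice = solve-∀

≅-opposite : ∀ {p q} → p + q ≅ + 0 [ 2 ] → q ≅ p [ 2 ]
≅-opposite {p} {q} (congruent k eq) = congruent (k + - p) (trans (isolate p q) (trans (cong (_+ - p) eq) (collect p k)))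
  where
  isolate : ∀ p q → q ≡ p + q + - p
  isolate = solve-∀
  collect : ∀ p k → + 0 + k * + 2 + - p ≡ p + (k + - p) * + 2
  collect = solve-∀

-- Null sequences and the multiplicative monoid ℂ

-- Applied to a difference of sequences this unfolds to `_≈ᴿ_`. Each congruence of real arithmetic
-- is therefore a rational identity combined with closure properties of null sequences.
Null : (ℕ → ℚ) → Set
Null s = ∀ ε → 0ℚ ℚ.< ε → ∃ λ N → ∀ n → N ℕ.≤ n → ℚ.∣ s n ∣ ℚ.≤ ε

Null-resp : ∀ {s t} → (∀ n → s n ≡ t n) → Null s → Null t
Null-resp s≗t null ε 0<ε with null ε 0<ε
... | N , p = N , λ n N≤n → subst (λ q → ℚ.∣ q ∣ ℚ.≤ ε) (s≗t n) (p n N≤n)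

Null-+ : ∀ {s t} → Null s → Null t → Null (λ n → s n ℚ.+ t n)
Null-+ {s} {t} null-s null-t ε 0<ε with null-s (½ ℚ.* ε) (half 0<ε) | null-t (½ ℚ.* ε) (half 0<ε)
... | M , p | N , q = M ℕ.⊔ N , λ n n≥ → begin
    ℚ.∣ s n ℚ.+ t n ∣          ≤⟨ ℚ.∣p+q∣≤∣p∣+∣q∣ (s n) (t n) ⟩
    ℚ.∣ s n ∣ ℚ.+ ℚ.∣ t n ∣    ≤⟨ ℚ.+-mono-≤ (p n (ℕ.m⊔n≤o⇒m≤o M N n≥)) (q n (ℕ.m⊔n≤o⇒n≤o M N n≥)) ⟩
    ½ ℚ.* ε ℚ.+ ½ ℚ.* ε        ≡⟨ halves ε ⟩
    ε                          ∎
  where open ℚ.≤-Reasoning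

Null-* : ∀ {s t} → IsCauchy s → Null t → Null (λ n → s n ℚ.* t n)
Null-* {s} {t} cauchy-s null-t ε 0<ε =
  let K , B , 0<B , s≤B = eventually-bounded {s} cauchy-s
      δ , 0<δ , Bδ≡ε    = divide 0<ε 0<B
      N , t≤δ           = null-t δ 0<δ
  in K ℕ.⊔ N , λ n n≥ → begin
    ℚ.∣ s n ℚ.* t n ∣          ≡⟨ ℚ.∣p*q∣≡∣p∣*∣q∣ (s n) (t n) ⟩
    ℚ.∣ s n ∣ ℚ.* ℚ.∣ t n ∣    ≤⟨ *-mono-≤-nonNeg (ℚ.<⇒≤ 0<B) (ℚ.0≤∣p∣ (t n))
                                    (s≤B n (ℕ.m⊔n≤o⇒m≤o K N n≥)) (t≤δ n (ℕ.m⊔n≤o⇒n≤o K N n≥)) ⟩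
    B ℚ.* δ                    ≡⟨ Bδ≡ε ⟩
    ε                          ∎
  where open ℚ.≤-Reasoning

module _ where
  open ℚ.+-*-Solver

  pointwise⇒≈ᴿ : ∀ {x y} → (∀ n → seq x n ≡ seq y n) → x ≈ᴿ y
  pointwise⇒≈ᴿ {x} {y} x≗y ε 0<ε = 0 , λ n _ →
    subst (λ q → ℚ.∣ q ∣ ℚ.≤ ε)
      (sym (trans (cong (ℚ._- seq y n) (x≗y n)) (ℚ.+-inverseʳ (seq y n)))) (ℚ.<⇒≤ 0<ε)

  ≈ᴿ-sym : ∀ {x y} → x ≈ᴿ y → y ≈ᴿ x
  ≈ᴿ-sym {x} {y} x≈y = Null-resp (λ n → flip (seq x n) (seq y n))
    (Null-* {λ _ → ℚ.- 1ℚ} (cauchy (fromℚ (ℚ.- 1ℚ))) x≈y)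
    where
    flip : ∀ p q → ℚ.- 1ℚ ℚ.* (p ℚ.- q) ≡ q ℚ.- p
    flip = solve 2 (λ p q → con (ℚ.- 1ℚ) :* (p :- q) := q :- p) refl

  ≈ᴿ-trans : ∀ {x y z} → x ≈ᴿ y → y ≈ᴿ z → x ≈ᴿ z
  ≈ᴿ-trans {x} {y} {z} x≈y y≈z = Null-resp (λ n → telescope (seq x n) (seq y n) (seq z n))
    (Null-+ x≈y y≈z)
    where
    telescope : ∀ p q r → (p ℚ.- q) ℚ.+ (q ℚ.- r) ≡ p ℚ.- r
    telescope = solve 3 (λ p q r → (p :- q) :+ (q :- r) := p :- r) refl

  +ᴿ-cong : ∀ {x y u v} → x ≈ᴿ y → u ≈ᴿ v → x +ᴿ u ≈ᴿ y +ᴿ v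
  +ᴿ-cong {x} {y} {u} {v} x≈y u≈v =
    Null-resp (λ n → regroup (seq x n) (seq y n) (seq u n) (seq v n)) (Null-+ x≈y u≈v)
    where
    regroup : ∀ p q r s → (p ℚ.- q) ℚ.+ (r ℚ.- s) ≡ (p ℚ.+ r) ℚ.- (q ℚ.+ s)
    regroup = solve 4 (λ p q r s → (p :- q) :+ (r :- s) := (p :+ r) :- (q :+ s)) refl

  -ᴿ-cong : ∀ {x y} → x ≈ᴿ y → -ᴿ x ≈ᴿ -ᴿ y
  -ᴿ-cong {x} {y} x≈y = Null-resp (λ n → negate (seq x n) (seq y n))
    (Null-* {λ _ → ℚ.- 1ℚ} (cauchy (fromℚ (ℚ.- 1ℚ))) x≈y)
    where
    negate : ∀ p q → ℚ.- 1ℚ ℚ.* (p ℚ.- q) ≡ (ℚ.- p) ℚ.- (ℚ.- q)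
    negate = solve 2 (λ p q → con (ℚ.- 1ℚ) :* (p :- q) := (:- p) :- (:- q)) refl

  *ᴿ-cong : ∀ {x y u v} → x ≈ᴿ y → u ≈ᴿ v → x *ᴿ u ≈ᴿ y *ᴿ v
  *ᴿ-cong {x} {y} {u} {v} x≈y u≈v =
    Null-resp (λ n → sym (*-diff (seq x n) (seq u n) (seq y n) (seq v n)))
      (Null-+ (Null-* {seq x} (cauchy x) u≈v) (Null-* {seq v} (cauchy v) x≈y))

  -x≈x⇒x≈0 : ∀ {x} → -ᴿ x ≈ᴿ x → x ≈ᴿ 0ᴿ
  -x≈x⇒x≈0 {x} -x≈x = Null-resp (λ n → halve (seq x n))
    (Null-* {λ _ → ℚ.- ½} (cauchy (fromℚ (ℚ.- ½))) -x≈x)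
    where
    halve : ∀ p → ℚ.- ½ ℚ.* ((ℚ.- p) ℚ.- p) ≡ p ℚ.- 0ℚ
    halve = solve 1 (λ p → con (ℚ.- ½) :* ((:- p) :- p) := p :- con 0ℚ) refl

  pointwise⇒≈ : ∀ {z w} → (∀ n → seq (re z) n ≡ seq (re w) n) →
                (∀ n → seq (im z) n ≡ seq (im w) n) → z ≈ w
  pointwise⇒≈ {z} {w} re≗ im≗ = pointwise⇒≈ᴿ {re z} {re w} re≗ , pointwise⇒≈ᴿ {im z} {im w} im≗

  ≈-refl : ∀ {z} → z ≈ z
  ≈-refl {z} = pointwise⇒≈ {z} {z} (λ _ → refl) (λ _ → refl)

  ≈-sym : ∀ {z w} → z ≈ w → w ≈ z
  ≈-sym {z} {w} (p , q) = ≈ᴿ-sym {re z} {re w} p , ≈ᴿ-sym {im z} {im w} q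

  ≈-trans : ∀ {z w u} → z ≈ w → w ≈ u → z ≈ u
  ≈-trans {z} {w} {u} (p , q) (p′ , q′) =
    ≈ᴿ-trans {re z} {re w} {re u} p p′ , ≈ᴿ-trans {im z} {im w} {im u} q q′

  ·-cong : ∀ {z w u v} → z ≈ w → u ≈ v → z · u ≈ w · v
  ·-cong {a +i b} {a′ +i b′} {c +i d} {c′ +i d′} (a≈ , b≈) (c≈ , d≈) =
    +ᴿ-cong {a *ᴿ c} {a′ *ᴿ c′} { -ᴿ (b *ᴿ d) } { -ᴿ (b′ *ᴿ d′) }
      (*ᴿ-cong {a} {a′} {c} {c′} a≈ c≈)
      (-ᴿ-cong {b *ᴿ d} {b′ *ᴿ d′} (*ᴿ-cong {b} {b′} {d} {d′} b≈ d≈)) ,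
    +ᴿ-cong {a *ᴿ d} {a′ *ᴿ d′} {b *ᴿ c} {b′ *ᴿ c′}
      (*ᴿ-cong {a} {a′} {d} {d′} a≈ d≈)
      (*ᴿ-cong {b} {b′} {c} {c′} b≈ c≈)

  ·-assoc : ∀ z w u → (z · w) · u ≈ z · (w · u)
  ·-assoc z w u = pointwise⇒≈ {(z · w) · u} {z · (w · u)}
    (λ n → real (seq (re z) n) (seq (im z) n) (seq (re w) n) (seq (im w) n) (seq (re u) n) (seq (im u) n))
    (λ n → imag (seq (re z) n) (seq (im z) n) (seq (re w) n) (seq (im w) n) (seq (re u) n) (seq (im u) n))
    where
    real : ∀ a b c d e f →
      (a ℚ.* c ℚ.+ ℚ.- (b ℚ.* d)) ℚ.* e ℚ.+ ℚ.- ((a ℚ.* d ℚ.+ b ℚ.* c) ℚ.* f) ≡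
      a ℚ.* (c ℚ.* e ℚ.+ ℚ.- (d ℚ.* f)) ℚ.+ ℚ.- (b ℚ.* (c ℚ.* f ℚ.+ d ℚ.* e))
    real = solve 6 (λ a b c d e f →
      (a :* c :+ :- (b :* d)) :* e :+ :- ((a :* d :+ b :* c) :* f) :=
      a :* (c :* e :+ :- (d :* f)) :+ :- (b :* (c :* f :+ d :* e))) refl
    imag : ∀ a b c d e f →
      (a ℚ.* c ℚ.+ ℚ.- (b ℚ.* d)) ℚ.* f ℚ.+ (a ℚ.* d ℚ.+ b ℚ.* c) ℚ.* e ≡
      a ℚ.* (c ℚ.* f ℚ.+ d ℚ.* e) ℚ.+ b ℚ.* (c ℚ.* e ℚ.+ ℚ.- (d ℚ.* f))
    imag = solve 6 (λ a b c d e f →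
      (a :* c :+ :- (b :* d)) :* f :+ (a :* d :+ b :* c) :* e :=
      a :* (c :* f :+ d :* e) :+ b :* (c :* e :+ :- (d :* f))) refl

  ·-comm : ∀ z w → z · w ≈ w · z
  ·-comm z w = pointwise⇒≈ {z · w} {w · z}
    (λ n → real (seq (re z) n) (seq (im z) n) (seq (re w) n) (seq (im w) n))
    (λ n → imag (seq (re z) n) (seq (im z) n) (seq (re w) n) (seq (im w) n))
    where
    real : ∀ a b c d → a ℚ.* c ℚ.+ ℚ.- (b ℚ.* d) ≡ c ℚ.* a ℚ.+ ℚ.- (d ℚ.* b)
    real = solve 4 (λ a b c d → a :* c :+ :- (b :* d) := c :* a :+ :- (d :* b)) refl
    imag : ∀ a b c d → a ℚ.* d ℚ.+ b ℚ.* c ≡ c ℚ.* b ℚ.+ d ℚ.* a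
    imag = solve 4 (λ a b c d → a :* d :+ b :* c := c :* b :+ d :* a) refl

  ·-identityˡ : ∀ z → 1ᶜ · z ≈ z
  ·-identityˡ z = pointwise⇒≈ {1ᶜ · z} {z}
    (λ n → real (seq (re z) n) (seq (im z) n)) (λ n → imag (seq (re z) n) (seq (im z) n))
    where
    real : ∀ a b → 1ℚ ℚ.* a ℚ.+ ℚ.- (0ℚ ℚ.* b) ≡ a
    real = solve 2 (λ a b → con 1ℚ :* a :+ :- (con 0ℚ :* b) := a) refl
    imag : ∀ a b → 1ℚ ℚ.* b ℚ.+ 0ℚ ℚ.* a ≡ b
    imag = solve 2 (λ a b → con 1ℚ :* b :+ con 0ℚ :* a := b) refl

  ·-zeroʳ : ∀ z → z · 0ᶜ ≈ 0ᶜ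
  ·-zeroʳ z = pointwise⇒≈ {z · 0ᶜ} {0ᶜ}
    (λ n → real (seq (re z) n) (seq (im z) n)) (λ n → imag (seq (re z) n) (seq (im z) n))
    where
    real : ∀ a b → a ℚ.* 0ℚ ℚ.+ ℚ.- (b ℚ.* 0ℚ) ≡ 0ℚ
    real = solve 2 (λ a b → a :* con 0ℚ :+ :- (b :* con 0ℚ) := con 0ℚ) refl
    imag : ∀ a b → a ℚ.* 0ℚ ℚ.+ b ℚ.* 0ℚ ≡ 0ℚ
    imag = solve 2 (λ a b → a :* con 0ℚ :+ b :* con 0ℚ := con 0ℚ) refl

  -1ᶜ : ℂ
  -1ᶜ = fromℚ (ℚ.- 1ℚ) +i 0ᴿ

  -- The one cancellation that requires no inverse of z: it amounts to halving, which is
  -- multiplication by a rational.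
  z·-1≈z⇒z≈0 : ∀ {z} → z · -1ᶜ ≈ z → z ≈ 0ᶜ
  z·-1≈z⇒z≈0 {z} (p , q) =
    -x≈x⇒x≈0 {re z} (≈ᴿ-trans { -ᴿ re z } {re (z · -1ᶜ)} {re z}
      (pointwise⇒≈ᴿ { -ᴿ re z } {re (z · -1ᶜ)} (λ n → real (seq (re z) n) (seq (im z) n))) p) ,
    -x≈x⇒x≈0 {im z} (≈ᴿ-trans { -ᴿ im z } {im (z · -1ᶜ)} {im z}
      (pointwise⇒≈ᴿ { -ᴿ im z } {im (z · -1ᶜ)} (λ n → imag (seq (re z) n) (seq (im z) n))) q)
    where
    real : ∀ a b → ℚ.- a ≡ a ℚ.* (ℚ.- 1ℚ) ℚ.+ ℚ.- (b ℚ.* 0ℚ)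
    real = solve 2 (λ a b → :- a := a :* con (ℚ.- 1ℚ) :+ :- (b :* con 0ℚ)) refl
    imag : ∀ a b → ℚ.- b ≡ a ℚ.* 0ℚ ℚ.+ b ℚ.* (ℚ.- 1ℚ)
    imag = solve 2 (λ a b → :- b := a :* con 0ℚ :+ b :* con (ℚ.- 1ℚ)) refl

-- The only numerical fact about √½ that the proof uses: it yields both α² = i and |α| = 1,
-- everything else being algebra.
√½²+√½²≈1 : √½ *ᴿ √½ +ᴿ √½ *ᴿ √½ ≈ᴿ 1ᴿ
√½²+√½²≈1 = ≈ᴿ-trans {√½ *ᴿ √½ +ᴿ √½ *ᴿ √½} {fromℚ ½ +ᴿ fromℚ ½} {1ᴿ}
  (+ᴿ-cong {√½ *ᴿ √½} {fromℚ ½} {√½ *ᴿ √½} {fromℚ ½} √½-square √½-square)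
  (pointwise⇒≈ᴿ {fromℚ ½ +ᴿ fromℚ ½} {1ᴿ} (λ _ → refl))

α·α≈𝕚 : α · α ≈ 𝕚
α·α≈𝕚 = pointwise⇒≈ᴿ {re (α · α)} {0ᴿ} (λ n → ℚ.+-inverseʳ (bisect n ℚ.* bisect n)) , √½²+√½²≈1

α·conjα≈1 : α · conj α ≈ 1ᶜ
α·conjα≈1 =
  ≈ᴿ-trans {re (α · conj α)} {√½ *ᴿ √½ +ᴿ √½ *ᴿ √½} {1ᴿ}
    (pointwise⇒≈ᴿ {re (α · conj α)} {√½ *ᴿ √½ +ᴿ √½ *ᴿ √½} (λ n → real (bisect n))) √½²+√½²≈1 ,
  pointwise⇒≈ᴿ {im (α · conj α)} {0ᴿ} (λ n → imag (bisect n))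
  where
  open ℚ.+-*-Solver
  real : ∀ s → s ℚ.* s ℚ.+ ℚ.- (s ℚ.* (ℚ.- s)) ≡ s ℚ.* s ℚ.+ s ℚ.* s
  real = solve 1 (λ s → s :* s :+ :- (s :* (:- s)) := s :* s :+ s :* s) refl
  imag : ∀ s → s ℚ.* (ℚ.- s) ℚ.+ s ℚ.* s ≡ 0ℚ
  imag = solve 1 (λ s → s :* (:- s) :+ s :* s := con 0ℚ) refl

·-commutativeMonoid : CommutativeMonoid 0ℓ 0ℓ
·-commutativeMonoid = record
  { Carrier = ℂ
  ; _≈_     = _≈_
  ; _∙_     = _·_
  ; ε       = 1ᶜ
  ; isCommutativeMonoid = record
    { isMonoid = record
      { isSemigroup = record
        { isMagma = record
          { isEquivalence = record
            { refl  = λ {z} → ≈-refl {z}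
            ; sym   = λ {z} {w} → ≈-sym {z} {w}
            ; trans = λ {z} {w} {u} → ≈-trans {z} {w} {u}
            }
          ; ∙-cong = λ {z} {w} {u} {v} → ·-cong {z} {w} {u} {v}
          }
        ; assoc = ·-assoc
        }
      ; identity = ·-identityˡ , λ z → ≈-trans {z · 1ᶜ} {1ᶜ · z} {z} (·-comm z 1ᶜ) (·-identityˡ z)
      }
    ; comm = ·-comm
    }
  }

-- Powers of α and 𝕚

-- The recursion `p-suc` at m = -1 reads ε = u ∙ p (-1), so u is a unit and p is its integer power
-- function. Every law then follows by two-sided induction, without separating positive powers from
-- powers of the conjugate. The module serves the bases α and 𝕚 alike.
module Powers (M : CommutativeMonoid 0ℓ 0ℓ) (u : CommutativeMonoid.Carrier M)
  (p : ℤ → CommutativeMonoid.Carrier M)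
  (p-zero : CommutativeMonoid._≈_ M (p (+ 0)) (CommutativeMonoid.ε M))
  (p-suc : ∀ m → CommutativeMonoid._≈_ M (p (+ 1 + m)) (CommutativeMonoid._∙_ M u (p m))) where

  open CommutativeMonoid M renaming (_≈_ to _≋_; refl to ≋-refl; sym to ≋-sym; trans to ≋-trans)
  open import Relation.Binary.Reasoning.Setoid setoid

  u-cancel : ∀ {x y} → u ∙ x ≋ u ∙ y → x ≋ y
  u-cancel {x} {y} ux≋uy = begin
    x                         ≈⟨ expand x ⟩
    p (- + 1) ∙ (u ∙ x)       ≈⟨ ∙-congˡ ux≋uy ⟩
    p (- + 1) ∙ (u ∙ y)       ≈⟨ expand y ⟨
    y                         ∎
    where
    expand : ∀ z → z ≋ p (- + 1) ∙ (u ∙ z)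
    expand z = begin
      z                       ≈⟨ identityˡ z ⟨
      ε ∙ z                   ≈⟨ ∙-congʳ p-zero ⟨
      p (+ 0) ∙ z             ≈⟨ ∙-congʳ (p-suc (- + 1)) ⟩
      (u ∙ p (- + 1)) ∙ z     ≈⟨ ∙-congʳ (comm u (p (- + 1))) ⟩
      (p (- + 1) ∙ u) ∙ z     ≈⟨ assoc (p (- + 1)) u z ⟩
      p (- + 1) ∙ (u ∙ z)     ∎

  -- With u = 𝕚 and q m = α ^ (+ 2 * m) this identifies the powers of 𝕚 with the even powers of α,
  -- negative exponents included.
  p-unique : ∀ (q : ℤ → Carrier) → q (+ 0) ≋ ε → (∀ m → q (+ 1 + m) ≋ u ∙ q m) → ∀ m → q m ≋ p m
  p-unique q q-zero q-suc = ℤ-induction (λ m → q m ≋ p m) (≋-trans q-zero (≋-sym p-zero))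
    (λ m eq → ≋-trans (q-suc m) (≋-trans (∙-congˡ eq) (≋-sym (p-suc m))))
    (λ m eq → u-cancel (≋-trans (≋-sym (q-suc m)) (≋-trans eq (p-suc m))))

  p-+ : ∀ m n → p (m + n) ≋ p m ∙ p n
  p-+ m n = ℤ-induction (λ m → p (m + n) ≋ p m ∙ p n)
    (begin
      p (+ 0 + n)             ≡⟨ cong p (ℤ.+-identityˡ n) ⟩
      p n                     ≈⟨ identityˡ (p n) ⟨
      ε ∙ p n                 ≈⟨ ∙-congʳ p-zero ⟨
      p (+ 0) ∙ p n           ∎)
    (λ m eq → begin
      p ((+ 1 + m) + n)       ≈⟨ left m ⟩
      u ∙ p (m + n)           ≈⟨ ∙-congˡ eq ⟩
      u ∙ (p m ∙ p n)         ≈⟨ right m ⟨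
      p (+ 1 + m) ∙ p n       ∎)
    (λ m eq → u-cancel (begin
      u ∙ p (m + n)           ≈⟨ left m ⟨
      p ((+ 1 + m) + n)       ≈⟨ eq ⟩
      p (+ 1 + m) ∙ p n       ≈⟨ right m ⟩
      u ∙ (p m ∙ p n)         ∎))
    m
    where
    left : ∀ m → p ((+ 1 + m) + n) ≋ u ∙ p (m + n)
    left m = ≋-trans (reflexive (cong p (ℤ.+-assoc (+ 1) m n))) (p-suc (m + n))
    right : ∀ m → p (+ 1 + m) ∙ p n ≋ u ∙ (p m ∙ p n)
    right m = ≋-trans (∙-congʳ (p-suc m)) (assoc u (p m) (p n))

  p-inverseʳ : ∀ m → p m ∙ p (- m) ≋ ε
  p-inverseʳ m = ≋-trans (≋-sym (p-+ m (- m))) (≋-trans (reflexive (cong p (ℤ.+-inverseʳ m))) p-zero)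

  module Periodic (period : ℕ) (p-period : p (+ period) ≋ ε) where

    p-multiple : ∀ q → p (q * + period) ≋ ε
    p-multiple = ℤ-induction (λ q → p (q * + period) ≋ ε) p-zero
      (λ q eq → ≋-trans (step q) eq)
      (λ q eq → ≋-trans (≋-sym (step q)) eq)
      where
      step : ∀ q → p ((+ 1 + q) * + period) ≋ p (q * + period)
      step q = begin
        p ((+ 1 + q) * + period)            ≡⟨ cong p (ℤ.suc-* q (+ period)) ⟩
        p (+ period + q * + period)         ≈⟨ p-+ (+ period) (q * + period) ⟩
        p (+ period) ∙ p (q * + period)     ≈⟨ ∙-congʳ p-period ⟩
        ε ∙ p (q * + period)                ≈⟨ identityˡ _ ⟩
        p (q * + period)                    ∎

    p-cong : ∀ {m n} → m ≅ n [ period ] → p m ≋ p n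
    p-cong {m} {n} (congruent q m≡n+q*period) = begin
      p m                          ≡⟨ cong p m≡n+q*period ⟩
      p (n + q * + period)         ≈⟨ p-+ n (q * + period) ⟩
      p n ∙ p (q * + period)       ≈⟨ ∙-congˡ (p-multiple q) ⟩
      p n ∙ ε                      ≈⟨ identityʳ (p n) ⟩
      p n                          ∎

  -- The hypothesis has the shape in which f is given on its support: y is the scalar λ, and `ε` is
  -- the value 1 of the indicator function.
  p-absorb : ∀ {x y} m n → x ≋ y ∙ ε ∙ p n → p m ∙ x ≋ y ∙ p (n + m)
  p-absorb {x} {y} m n eq = begin
    p m ∙ x                  ≈⟨ ∙-congˡ eq ⟩
    p m ∙ (y ∙ ε ∙ p n)      ≈⟨ comm (p m) (y ∙ ε ∙ p n) ⟩
    (y ∙ ε ∙ p n) ∙ p m      ≈⟨ assoc (y ∙ ε) (p n) (p m) ⟩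
    y ∙ ε ∙ (p n ∙ p m)      ≈⟨ ∙-cong (identityʳ y) (≋-sym (p-+ n m)) ⟩
    y ∙ p (n + m)            ∎

  p-split : ∀ {x y z} m n → x ≋ y ∙ p (m + n) → z ≋ p n → x ≋ (y ∙ p m) ∙ z
  p-split {x} {y} {z} m n eq z≋ = begin
    x                        ≈⟨ eq ⟩
    y ∙ p (m + n)            ≈⟨ ∙-congˡ (p-+ m n) ⟩
    y ∙ (p m ∙ p n)          ≈⟨ assoc y (p m) (p n) ⟨
    (y ∙ p m) ∙ p n          ≈⟨ ∙-congˡ z≋ ⟨
    (y ∙ p m) ∙ z            ∎

  stabiliser-+ : ∀ {x} m n → x ∙ p m ≋ x → x ∙ p n ≋ x → x ∙ p (m + n) ≋ x
  stabiliser-+ {x} m n xm xn = begin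
    x ∙ p (m + n)       ≈⟨ ∙-congˡ (p-+ m n) ⟩
    x ∙ (p m ∙ p n)     ≈⟨ assoc x (p m) (p n) ⟨
    (x ∙ p m) ∙ p n     ≈⟨ ∙-congʳ xm ⟩
    x ∙ p n             ≈⟨ xn ⟩
    x                   ∎

  -- Dividing the two equations would be immediate if x and y were invertible. Instead both are
  -- raised to the common right side y ∙ p (b + b′), which shows x ∙ p (a + b′) ≋ x ∙ p (a′ + b);
  -- only powers of u are inverted.
  ratio-stabilises : ∀ {x y} a b a′ b′ → x ∙ p a ≋ y ∙ p b → x ∙ p a′ ≋ y ∙ p b′ →
                     x ∙ p ((a + b′) + - (a′ + b)) ≋ x
  ratio-stabilises {x} {y} a b a′ b′ eq eq′ = begin
    x ∙ p ((a + b′) + - (a′ + b))            ≈⟨ ∙-congˡ (p-+ (a + b′) (- (a′ + b))) ⟩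
    x ∙ (p (a + b′) ∙ p (- (a′ + b)))        ≈⟨ assoc x (p (a + b′)) (p (- (a′ + b))) ⟨
    (x ∙ p (a + b′)) ∙ p (- (a′ + b))        ≈⟨ ∙-congʳ (exchange a b b′ eq) ⟩
    (y ∙ p (b + b′)) ∙ p (- (a′ + b))        ≡⟨ cong (λ m → (y ∙ p m) ∙ p (- (a′ + b))) (ℤ.+-comm b b′) ⟩
    (y ∙ p (b′ + b)) ∙ p (- (a′ + b))        ≈⟨ ∙-congʳ (exchange a′ b′ b eq′) ⟨
    (x ∙ p (a′ + b)) ∙ p (- (a′ + b))        ≈⟨ assoc x (p (a′ + b)) (p (- (a′ + b))) ⟩
    x ∙ (p (a′ + b) ∙ p (- (a′ + b)))        ≈⟨ ∙-congˡ (p-inverseʳ (a′ + b)) ⟩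
    x ∙ ε                                    ≈⟨ identityʳ x ⟩
    x                                        ∎
    where
    exchange : ∀ a b c → x ∙ p a ≋ y ∙ p b → x ∙ p (a + c) ≋ y ∙ p (b + c)
    exchange a b c eq = begin
      x ∙ p (a + c)        ≈⟨ ∙-congˡ (p-+ a c) ⟩
      x ∙ (p a ∙ p c)      ≈⟨ assoc x (p a) (p c) ⟨
      (x ∙ p a) ∙ p c      ≈⟨ ∙-congʳ eq ⟩
      (y ∙ p b) ∙ p c      ≈⟨ assoc y (p b) (p c) ⟩
      y ∙ (p b ∙ p c)      ≈⟨ ∙-congˡ (p-+ b c) ⟨
      y ∙ p (b + c)        ∎

^-suc : ∀ z → z · conj z ≈ 1ᶜ → ∀ m → z ^ (+ 1 + m) ≈ z · z ^ m
^-suc z unit (+ n)         = ≈-refl {z · z ^ℕ n}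
^-suc z unit -[1+ zero ]   = begin
  1ᶜ                         ≈⟨ unit ⟨
  z · conj z                 ≈⟨ ∙-congˡ {z} {conj z · 1ᶜ} {conj z} (identityʳ (conj z)) ⟨
  z · (conj z · 1ᶜ)          ∎
  where
  open CommutativeMonoid ·-commutativeMonoid using (setoid; ∙-congˡ; identityʳ)
  open import Relation.Binary.Reasoning.Setoid setoid
^-suc z unit -[1+ suc n ]  = begin
  conj z ^ℕ suc n                          ≈⟨ ·-identityˡ (conj z ^ℕ suc n) ⟨
  1ᶜ · conj z ^ℕ suc n                     ≈⟨ ∙-congʳ {conj z ^ℕ suc n} {z · conj z} {1ᶜ} unit ⟨
  (z · conj z) · conj z ^ℕ suc n           ≈⟨ ·-assoc z (conj z) (conj z ^ℕ suc n) ⟩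
  z · (conj z · conj z ^ℕ suc n)           ∎
  where
  open CommutativeMonoid ·-commutativeMonoid using (setoid; ∙-congʳ)
  open import Relation.Binary.Reasoning.Setoid setoid

module _ where
  open CommutativeMonoid ·-commutativeMonoid using (setoid; ∙-congˡ; ∙-congʳ; identityʳ)
  open import Relation.Binary.Reasoning.Setoid setoid

  module α^ = Powers ·-commutativeMonoid α (α ^_) (≈-refl {1ᶜ}) (^-suc α α·conjα≈1)

  α²≈𝕚 : α ^ (+ 2) ≈ 𝕚
  α²≈𝕚 = begin
    α · (α · 1ᶜ)    ≈⟨ ∙-congˡ {α} {α · 1ᶜ} {α} (identityʳ α) ⟩
    α · α           ≈⟨ α·α≈𝕚 ⟩
    𝕚               ∎

  α⁴≈-1 : α ^ (+ 4) ≈ -1ᶜ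
  α⁴≈-1 = begin
    α ^ (+ 4)                ≈⟨ α^.p-+ (+ 2) (+ 2) ⟩
    α ^ (+ 2) · α ^ (+ 2)    ≈⟨ ·-cong {α ^ (+ 2)} {𝕚} {α ^ (+ 2)} {𝕚} α²≈𝕚 α²≈𝕚 ⟩
    𝕚 · 𝕚                    ≈⟨ pointwise⇒≈ {𝕚 · 𝕚} { -1ᶜ} (λ _ → refl) (λ _ → refl) ⟩
    -1ᶜ                      ∎

  α⁸≈1 : α ^ (+ 8) ≈ 1ᶜ
  α⁸≈1 = begin
    α ^ (+ 8)                ≈⟨ α^.p-+ (+ 4) (+ 4) ⟩
    α ^ (+ 4) · α ^ (+ 4)    ≈⟨ ·-cong {α ^ (+ 4)} { -1ᶜ} {α ^ (+ 4)} { -1ᶜ} α⁴≈-1 α⁴≈-1 ⟩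
    -1ᶜ · -1ᶜ                ≈⟨ pointwise⇒≈ { -1ᶜ · -1ᶜ} {1ᶜ} (λ _ → refl) (λ _ → refl) ⟩
    1ᶜ                       ∎

  open α^.Periodic 8 α⁸≈1 public using () renaming (p-cong to α^-cong)

  𝕚^≈α^2* : ∀ m → 𝕚 ^ m ≈ α ^ (+ 2 * m)
  𝕚^≈α^2* m = ≈-sym {α ^ (+ 2 * m)} {𝕚 ^ m}
    (𝕚^.p-unique (λ m → α ^ (+ 2 * m)) (≈-refl {1ᶜ}) double-suc m)
    where
    𝕚·conj𝕚≈1 : 𝕚 · conj 𝕚 ≈ 1ᶜ
    𝕚·conj𝕚≈1 = pointwise⇒≈ {𝕚 · conj 𝕚} {1ᶜ} (λ _ → refl) (λ _ → refl)
    module 𝕚^ = Powers ·-commutativeMonoid 𝕚 (𝕚 ^_) (≈-refl {1ᶜ}) (^-suc 𝕚 𝕚·conj𝕚≈1)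
    double-suc : ∀ m → α ^ (+ 2 * (+ 1 + m)) ≈ 𝕚 · α ^ (+ 2 * m)
    double-suc m = begin
      α ^ (+ 2 * (+ 1 + m))          ≡⟨ cong (α ^_) (ℤ.*-distribˡ-+ (+ 2) (+ 1) m) ⟩
      α ^ (+ 2 + + 2 * m)            ≈⟨ α^.p-+ (+ 2) (+ 2 * m) ⟩
      α ^ (+ 2) · α ^ (+ 2 * m)      ≈⟨ ∙-congʳ {α ^ (+ 2 * m)} {α ^ (+ 2)} {𝕚} α²≈𝕚 ⟩
      𝕚 · α ^ (+ 2 * m)              ∎

  α^·z≈0⇒z≈0 : ∀ m {z} → α ^ m · z ≈ 0ᶜ → z ≈ 0ᶜ
  α^·z≈0⇒z≈0 m {z} eq = begin
    z                              ≈⟨ ·-identityˡ z ⟨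
    1ᶜ · z                         ≈⟨ ∙-congʳ {z} {α ^ (- m) · α ^ m} {1ᶜ} inverse ⟨
    (α ^ (- m) · α ^ m) · z        ≈⟨ ·-assoc (α ^ (- m)) (α ^ m) z ⟩
    α ^ (- m) · (α ^ m · z)        ≈⟨ ∙-congˡ {α ^ (- m)} {α ^ m · z} {0ᶜ} eq ⟩
    α ^ (- m) · 0ᶜ                 ≈⟨ ·-zeroʳ (α ^ (- m)) ⟩
    0ᶜ                             ∎
    where
    inverse : α ^ (- m) · α ^ m ≈ 1ᶜ
    inverse = ≈-trans {α ^ (- m) · α ^ m} {α ^ m · α ^ (- m)} {1ᶜ}
      (·-comm (α ^ (- m)) (α ^ m)) (α^.p-inverseʳ m)

module _ {z : ℂ} (z≉0 : z ≉ 0ᶜ) where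
  open CommutativeMonoid ·-commutativeMonoid using (setoid; ∙-congˡ)
  open import Relation.Binary.Reasoning.Setoid setoid

  Stabilises : ℤ → Set
  Stabilises m = z · α ^ m ≈ z

  stabilises-cong : ∀ {m n} → m ≅ n [ 8 ] → Stabilises m → Stabilises n
  stabilises-cong {m} {n} m≅n eq = begin
    z · α ^ n       ≈⟨ ∙-congˡ {z} {α ^ m} {α ^ n} (α^-cong m≅n) ⟨
    z · α ^ m       ≈⟨ eq ⟩
    z               ∎

  stabilises-double : ∀ m → Stabilises m → Stabilises (m + m)
  stabilises-double m eq = α^.stabiliser-+ {z} m m eq eq

  ¬stabilises-4 : ¬ Stabilises (+ 4)
  ¬stabilises-4 eq = z≉0 (z·-1≈z⇒z≈0 {z} (begin
    z · -1ᶜ           ≈⟨ ∙-congˡ {z} {α ^ (+ 4)} { -1ᶜ} α⁴≈-1 ⟨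
    z · α ^ (+ 4)     ≈⟨ eq ⟩
    z                 ∎))

  -- every residue r ≢ 0 mod 8 reaches 4 by repeated doubling
  stabilises-residue : ∀ r → r ℕ.< 8 → Stabilises (+ r) → r ≡ 0
  stabilises-residue 0 _ _ = refl
  stabilises-residue 1 _ st = contradiction (stabilises-double (+ 2) (stabilises-double (+ 1) st)) ¬stabilises-4
  stabilises-residue 2 _ st = contradiction (stabilises-double (+ 2) st) ¬stabilises-4
  stabilises-residue 3 _ st = contradiction (stabilises-cong {+ 12} {+ 4} (congruent (+ 1) refl)
    (stabilises-double (+ 6) (stabilises-double (+ 3) st))) ¬stabilises-4
  stabilises-residue 4 _ st = contradiction st ¬stabilises-4
  stabilises-residue 5 _ st = contradiction (stabilises-cong {+ 20} {+ 4} (congruent (+ 2) refl)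
    (stabilises-double (+ 10) (stabilises-double (+ 5) st))) ¬stabilises-4
  stabilises-residue 6 _ st = contradiction (stabilises-cong {+ 12} {+ 4} (congruent (+ 1) refl)
    (stabilises-double (+ 6) st)) ¬stabilises-4
  stabilises-residue 7 _ st = contradiction (stabilises-cong {+ 28} {+ 4} (congruent (+ 3) refl)
    (stabilises-double (+ 14) (stabilises-double (+ 7) st))) ¬stabilises-4
  stabilises-residue (suc (suc (suc (suc (suc (suc (suc (suc r)))))))) r<8 =
    contradiction r<8 (ℕ.m+n≮m 8 r)

  stabilises⇒≅0 : ∀ m → Stabilises m → m ≅ + 0 [ 8 ]
  stabilises⇒≅0 m st = congruent (m /ℕ 8) (trans (a≡a%ℕn+[a/ℕn]*n m 8) (cong (λ r → + r + (m /ℕ 8) * + 8)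
    (stabilises-residue (m %ℕ 8) (n%ℕd<d m 8)
      (stabilises-cong {m} {+ (m %ℕ 8)} (congruent (m /ℕ 8) (a≡a%ℕn+[a/ℕn]*n m 8)) st))))

-- Multilinear polynomials

∑⊆-cong : ∀ r {F G : Subset r → ℤ} → (∀ S → F S ≡ G S) → ∑⊆ r F ≡ ∑⊆ r G
∑⊆-cong zero    F≗G = F≗G []
∑⊆-cong (suc r) F≗G = cong₂ _+_ (∑⊆-cong r (F≗G ∘ (outside ∷_))) (∑⊆-cong r (F≗G ∘ (inside ∷_)))

∑⊆-+ : ∀ r (F G : Subset r → ℤ) → ∑⊆ r (λ S → F S + G S) ≡ ∑⊆ r F + ∑⊆ r G
∑⊆-+ zero    F G = refl
∑⊆-+ (suc r) F G =
  trans (cong₂ _+_ (∑⊆-+ r (F ∘ (outside ∷_)) (G ∘ (outside ∷_))) (∑⊆-+ r (F ∘ (inside ∷_)) (G ∘ (inside ∷_))))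
        (+-interchange (∑⊆ r (F ∘ (outside ∷_))) (∑⊆ r (G ∘ (outside ∷_))) (∑⊆ r (F ∘ (inside ∷_))) (∑⊆ r (G ∘ (inside ∷_))))

∑⊆-*ˡ : ∀ r k (F : Subset r → ℤ) → ∑⊆ r (λ S → k * F S) ≡ k * ∑⊆ r F
∑⊆-*ˡ zero    k F = refl
∑⊆-*ˡ (suc r) k F =
  trans (cong₂ _+_ (∑⊆-*ˡ r k (F ∘ (outside ∷_))) (∑⊆-*ˡ r k (F ∘ (inside ∷_))))
        (sym (ℤ.*-distribˡ-+ k _ _))

poly : ∀ {r} → (Subset r → ℤ) → Bits r → ℤ
poly {r} C y = ∑⊆ r λ S → C S * ∏∈ S (bit ∘ lookup y)

poly-cong : ∀ {r} {C D : Subset r → ℤ} → (∀ S → C S ≡ D S) → ∀ y → poly C y ≡ poly D y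
poly-cong {r} C≗D y = ∑⊆-cong r (λ S → cong (_* ∏∈ S (bit ∘ lookup y)) (C≗D S))

poly-+ : ∀ {r} (C D : Subset r → ℤ) y → poly (λ S → C S + D S) y ≡ poly C y + poly D y
poly-+ {r} C D y = trans (∑⊆-cong r (λ S → ℤ.*-distribʳ-+ (∏∈ S (bit ∘ lookup y)) (C S) (D S))) (∑⊆-+ r _ _)

poly-*ˡ : ∀ {r} k (C : Subset r → ℤ) y → poly (λ S → k * C S) y ≡ k * poly C y
poly-*ˡ {r} k C y = trans (∑⊆-cong r (λ S → ℤ.*-assoc k (C S) (∏∈ S (bit ∘ lookup y)))) (∑⊆-*ˡ r k _)

poly-∷ : ∀ {r} (C : Subset (suc r) → ℤ) y₀ (y : Bits r) →
  poly C (y₀ ∷ y) ≡ poly (C ∘ (outside ∷_)) y + bit y₀ * poly (C ∘ (inside ∷_)) y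
poly-∷ {r} C y₀ y = cong₂ _+_
  (∑⊆-cong r (λ S → cong (C (outside ∷ S) *_) (ℤ.*-identityˡ (∏∈ S (bit ∘ lookup y)))))
  (trans (∑⊆-cong r (λ S → x∙yz≈y∙xz (C (inside ∷ S)) (bit y₀) (∏∈ S (bit ∘ lookup y)))) (∑⊆-*ˡ r (bit y₀) _))

-- Setting the first variable to 0 leaves the polynomial of the sets without it; subtracting this
-- from the value at 1 leaves the polynomial of the sets containing it. Both vanish modulo m, so
-- induction applies to each.
poly-coefficients : ∀ {r m} (C : Subset r → ℤ) → (∀ y → poly C y ≅ + 0 [ m ]) → ∀ S → C S ≅ + 0 [ m ]
poly-coefficients {zero} {m} C C≅0 [] with C≅0 []
... | congruent q eq = congruent q (trans (sym (ℤ.*-identityʳ (C []))) eq)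
poly-coefficients {suc r} {m} C C≅0 (outside ∷ S) = poly-coefficients (C ∘ (outside ∷_)) vanish S
  where
  vanish : ∀ y → poly (C ∘ (outside ∷_)) y ≅ + 0 [ m ]
  vanish y with C≅0 (false ∷ y)
  ... | congruent q eq = congruent q (trans (sym (trans (poly-∷ C false y) (ℤ.+-identityʳ _))) eq)
poly-coefficients {suc r} {m} C C≅0 (inside ∷ S) = poly-coefficients (C ∘ (inside ∷_)) vanish S
  where
  P Q : Bits r → ℤ
  P = poly (C ∘ (outside ∷_))
  Q = poly (C ∘ (inside ∷_))
  difference : ∀ p q k l n → p + + 0 * q ≡ + 0 + k * n → p + + 1 * q ≡ + 0 + l * n → q ≡ + 0 + (l + - k) * n
  difference p q k l n eq₀ eq₁ =
    trans (lhs p q) (trans (cong₂ (λ s t → s + - t) eq₁ eq₀) (rhs k l n))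
    where
    lhs : ∀ p q → q ≡ (p + + 1 * q) + - (p + + 0 * q)
    lhs = solve-∀
    rhs : ∀ k l n → (+ 0 + l * n) + - (+ 0 + k * n) ≡ + 0 + (l + - k) * n
    rhs = solve-∀
  vanish : ∀ y → Q y ≅ + 0 [ m ]
  vanish y with C≅0 (false ∷ y) | C≅0 (true ∷ y)
  ... | congruent k eq₀ | congruent l eq₁ = congruent (l + - k)
    (difference (P y) (Q y) k l (+ m) (trans (sym (poly-∷ C false y)) eq₀) (trans (sym (poly-∷ C true y)) eq₁))

-- δ₀, δ₁ and δ₂ are Kronecker deltas that select the part of degree 0, 1 or 2. They are shifts of
-- one another, so that prefixing a set by `inside` turns δ₂ into δ₁ and δ₁ into δ₀ by computation.
δ₀ : ℕ → ℤ
δ₀ zero    = + 1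
δ₀ (suc _) = + 0

δ₁ : ℕ → ℤ
δ₁ zero    = + 0
δ₁ (suc k) = δ₀ k

δ₂ : ℕ → ℤ
δ₂ zero    = + 0
δ₂ (suc k) = δ₁ k

poly-δ₀ : ∀ {r} (C : Subset r → ℤ) y → poly (λ S → δ₀ ∣ S ∣ * C S) y ≡ C ⊥
poly-δ₀ {zero}  C []       = trans (ℤ.*-identityʳ _) (ℤ.*-identityˡ (C []))
poly-δ₀ {suc r} C (y₀ ∷ y) = begin
  poly (λ S → δ₀ ∣ S ∣ * C S) (y₀ ∷ y)
    ≡⟨ poly-∷ (λ S → δ₀ ∣ S ∣ * C S) y₀ y ⟩
  poly (λ S → δ₀ ∣ S ∣ * C (outside ∷ S)) y + bit y₀ * poly (λ S → + 0 * C (inside ∷ S)) y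
    ≡⟨ cong₂ (λ p q → p + bit y₀ * q) (poly-δ₀ (C ∘ (outside ∷_)) y) (poly-*ˡ (+ 0) (C ∘ (inside ∷_)) y) ⟩
  C ⊥ + bit y₀ * + 0
    ≡⟨ cong (_+_ (C ⊥)) (ℤ.*-zeroʳ (bit y₀)) ⟩
  C ⊥ + + 0
    ≡⟨ ℤ.+-identityʳ (C ⊥) ⟩
  C ⊥ ∎
  where open ≡-Reasoning

linear≡poly : ∀ {r} (c : Subset r → ℤ) y → linear (λ j → c ⁅ j ⁆) y ≡ poly (λ S → δ₁ ∣ S ∣ * c S) y
linear≡poly {zero}  c []       = refl
linear≡poly {suc r} c (y₀ ∷ y) = begin
  c ⁅ zero ⁆ * bit y₀ + linear (λ j → c (outside ∷ ⁅ j ⁆)) y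
    ≡⟨ cong₂ _+_ (ℤ.*-comm (c ⁅ zero ⁆) (bit y₀)) (linear≡poly (c ∘ (outside ∷_)) y) ⟩
  bit y₀ * c ⁅ zero ⁆ + poly (λ S → δ₁ ∣ S ∣ * c (outside ∷ S)) y
    ≡⟨ ℤ.+-comm (bit y₀ * c ⁅ zero ⁆) _ ⟩
  poly (λ S → δ₁ ∣ S ∣ * c (outside ∷ S)) y + bit y₀ * c ⁅ zero ⁆
    ≡⟨ cong (λ p → poly (λ S → δ₁ ∣ S ∣ * c (outside ∷ S)) y + bit y₀ * p) (poly-δ₀ (c ∘ (inside ∷_)) y) ⟨
  poly (λ S → δ₁ ∣ S ∣ * c (outside ∷ S)) y + bit y₀ * poly (λ S → δ₀ ∣ S ∣ * c (inside ∷ S)) y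
    ≡⟨ poly-∷ (λ S → δ₁ ∣ S ∣ * c S) y₀ y ⟨
  poly (λ S → δ₁ ∣ S ∣ * c S) (y₀ ∷ y) ∎
  where open ≡-Reasoning

quadratic≡poly : ∀ {r} (c : Subset r → ℤ) y →
  quadratic (λ j k → c (⁅ j ⁆ ∪ ⁅ k ⁆)) y ≡ poly (λ S → δ₂ ∣ S ∣ * c S) y
quadratic≡poly {zero}  c []       = refl
quadratic≡poly {suc r} c (y₀ ∷ y) = begin
  -- The row j = 0 keeps every k > 0 and is y₀ times a linear form; each later row loses its entry
  -- at k = 0 and belongs to the quadratic form in the remaining variables.
  (+ 0 + sum (λ k → c (inside ∷ (⊥ ∪ ⁅ k ⁆)) * (bit y₀ * bit (lookup y k))))
    + sum (λ j → + 0 + sum (λ k → row j k))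
    ≡⟨ cong₂ _+_ (trans (ℤ.+-identityˡ _) first-row) (trans (sum-cong-≗ {r} {λ j → + 0 + sum (row j)} {λ j → sum (row j)} (λ j → ℤ.+-identityˡ (sum (row j)))) (quadratic≡poly (c ∘ (outside ∷_)) y)) ⟩
  bit y₀ * linear (λ k → c (inside ∷ ⁅ k ⁆)) y + poly (λ S → δ₂ ∣ S ∣ * c (outside ∷ S)) y
    ≡⟨ ℤ.+-comm (bit y₀ * linear (λ k → c (inside ∷ ⁅ k ⁆)) y) _ ⟩
  poly (λ S → δ₂ ∣ S ∣ * c (outside ∷ S)) y + bit y₀ * linear (λ k → c (inside ∷ ⁅ k ⁆)) y
    ≡⟨ cong (λ p → poly (λ S → δ₂ ∣ S ∣ * c (outside ∷ S)) y + bit y₀ * p) (linear≡poly (c ∘ (inside ∷_)) y) ⟩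
  poly (λ S → δ₂ ∣ S ∣ * c (outside ∷ S)) y + bit y₀ * poly (λ S → δ₁ ∣ S ∣ * c (inside ∷ S)) y
    ≡⟨ poly-∷ (λ S → δ₂ ∣ S ∣ * c S) y₀ y ⟨
  poly (λ S → δ₂ ∣ S ∣ * c S) (y₀ ∷ y) ∎
  where
  open ≡-Reasoning
  row : Fin r → Fin r → ℤ
  row j k = if does (j <? k) then c (outside ∷ (⁅ j ⁆ ∪ ⁅ k ⁆)) * (bit (lookup y j) * bit (lookup y k)) else + 0
  first-row : sum (λ k → c (inside ∷ (⊥ ∪ ⁅ k ⁆)) * (bit y₀ * bit (lookup y k))) ≡
              bit y₀ * linear (λ k → c (inside ∷ ⁅ k ⁆)) y
  first-row = trans
    (sum-cong-≗ (λ k → trans (cong (λ S → c (inside ∷ S) * (bit y₀ * bit (lookup y k))) (∪-identityˡ ⁅ k ⁆))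
                             (x∙yz≈y∙xz (c (inside ∷ ⁅ k ⁆)) (bit y₀) (bit (lookup y k)))))
    (sym (*-distribˡ-sum (bit y₀) (λ k → c (inside ∷ ⁅ k ⁆) * bit (lookup y k))))

-- The factors 1, 2, 4 of L + 2Q + 4H as a function of the degree. The value 0 at degree 0 records
-- that `exponent` has no constant term.
weight : ℕ → ℤ
weight 0 = + 0
weight 1 = + 1
weight 2 = + 2
weight (suc (suc (suc _))) = + 4

exponent≡poly : ∀ {r} (c : Subset r → ℤ) y → exponent c y ≡ poly (λ S → weight ∣ S ∣ * c S) y
exponent≡poly {r} c y = begin
  linear (λ j → c ⁅ j ⁆) y + + 2 * quadratic (λ j k → c (⁅ j ⁆ ∪ ⁅ k ⁆)) y + + 4 * higher c y
    ≡⟨ cong₂ _+_ (cong₂ (λ p q → p + + 2 * q) (linear≡poly c y) (quadratic≡poly c y))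
                 (sym (∑⊆-*ˡ r (+ 4) _)) ⟩
  poly (λ S → δ₁ ∣ S ∣ * c S) y + + 2 * poly (λ S → δ₂ ∣ S ∣ * c S) y
    + ∑⊆ r (λ S → + 4 * (if does (3 ℕ.≤? ∣ S ∣) then c S * ∏∈ S (bit ∘ lookup y) else + 0))
    ≡⟨ cong₂ _+_ (cong (_+_ (poly (λ S → δ₁ ∣ S ∣ * c S) y)) (sym (poly-*ˡ (+ 2) (λ S → δ₂ ∣ S ∣ * c S) y)))
                 refl ⟩
  poly (λ S → δ₁ ∣ S ∣ * c S) y + poly (λ S → + 2 * (δ₂ ∣ S ∣ * c S)) y
    + ∑⊆ r (λ S → + 4 * (if does (3 ℕ.≤? ∣ S ∣) then c S * ∏∈ S (bit ∘ lookup y) else + 0))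
    ≡⟨ cong₂ _+_ (sym (poly-+ (λ S → δ₁ ∣ S ∣ * c S) (λ S → + 2 * (δ₂ ∣ S ∣ * c S)) y)) refl ⟩
  poly (λ S → δ₁ ∣ S ∣ * c S + + 2 * (δ₂ ∣ S ∣ * c S)) y
    + ∑⊆ r (λ S → + 4 * (if does (3 ℕ.≤? ∣ S ∣) then c S * ∏∈ S (bit ∘ lookup y) else + 0))
    ≡⟨ ∑⊆-+ r _ _ ⟨
  ∑⊆ r (λ S → (δ₁ ∣ S ∣ * c S + + 2 * (δ₂ ∣ S ∣ * c S)) * ∏∈ S (bit ∘ lookup y)
    + + 4 * (if does (3 ℕ.≤? ∣ S ∣) then c S * ∏∈ S (bit ∘ lookup y) else + 0))
    ≡⟨ ∑⊆-cong r (λ S → combine ∣ S ∣ (c S) (∏∈ S (bit ∘ lookup y))) ⟩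
  poly (λ S → weight ∣ S ∣ * c S) y ∎
  where
  open ≡-Reasoning
  combine : ∀ k p q → (δ₁ k * p + + 2 * (δ₂ k * p)) * q + + 4 * (if does (3 ℕ.≤? k) then p * q else + 0) ≡
                      weight k * p * q
  combine 0 = k₀
    where
    k₀ : ∀ p q → (+ 0 * p + + 2 * (+ 0 * p)) * q + + 4 * + 0 ≡ + 0 * p * q
    k₀ = solve-∀
  combine 1 = k₁
    where
    k₁ : ∀ p q → (+ 1 * p + + 2 * (+ 0 * p)) * q + + 4 * + 0 ≡ + 1 * p * q
    k₁ = solve-∀
  combine 2 = k₂
    where
    k₂ : ∀ p q → (+ 0 * p + + 2 * (+ 1 * p)) * q + + 4 * + 0 ≡ + 2 * p * q
    k₂ = solve-∀
  combine (suc (suc (suc _))) = k₃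
    where
    k₃ : ∀ p q → (+ 0 * p + + 2 * (+ 0 * p)) * q + + 4 * (p * q) ≡ + 4 * p * q
    k₃ = solve-∀

-- Affine forms over ℤ₂

-- The constant term is an accumulator: fixing the first variable leaves an affine form in the
-- others. Inductions therefore have to keep b arbitrary.
affine : ∀ {r} → (Fin r → Bool) → Bool → Bits r → Bool
affine a b []       = b
affine a b (y₀ ∷ y) = affine (a ∘ suc) (b xor (a zero ∧ y₀)) y

-- The sign (-1)^b, which makes addition of b over ℤ₂ an affine map over ℤ.
sgn : Bool → ℤ
sgn b = + 1 + - (+ 2 * bit b)

bit-xor : ∀ b t → bit (b xor t) ≡ bit b + sgn b * bit t
bit-xor false false = refl
bit-xor false true  = refl
bit-xor true  false = refl
bit-xor true  true  = refl

bit-∧ : ∀ p q → bit (p ∧ q) ≡ bit p * bit q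
bit-∧ false _ = refl
bit-∧ true  q = sym (ℤ.*-identityˡ (bit q))

sgn≅1 : ∀ b → sgn b ≅ + 1 [ 2 ]
sgn≅1 b = congruent (- bit b) (move (bit b))
  where
  move : ∀ t → + 1 + - (+ 2 * t) ≡ + 1 + - t * + 2
  move = solve-∀

bit-xor-≅ : ∀ b t → bit (b xor t) ≅ bit b + bit t [ 2 ]
bit-xor-≅ b t = ≅-trans (≡⇒≅ (bit-xor b t))
  (+-congˡ-≅ (bit b) (≅-trans (*-congʳ-≅ (bit t) (sgn≅1 b)) (≡⇒≅ (ℤ.*-identityˡ (bit t)))))

affine-≅ : ∀ {r} (a : Fin r → Bool) b y →
  bit (affine a b y) ≅ sum (λ j → bit (a j) * bit (lookup y j)) + bit b [ 2 ]
affine-≅ a b []       = ≡⇒≅ (sym (ℤ.+-identityˡ (bit b)))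
affine-≅ {suc r} a b (y₀ ∷ y) = begin
  bit (affine (a ∘ suc) (b xor (a zero ∧ y₀)) y)          ≈⟨ affine-≅ (a ∘ suc) (b xor (a zero ∧ y₀)) y ⟩
  rest + bit (b xor (a zero ∧ y₀))                        ≈⟨ +-congˡ-≅ rest (bit-xor-≅ b (a zero ∧ y₀)) ⟩
  rest + (bit b + bit (a zero ∧ y₀))                      ≡⟨ cong (λ t → rest + (bit b + t)) (bit-∧ (a zero) y₀) ⟩
  rest + (bit b + bit (a zero) * bit y₀)                  ≡⟨ rotate rest (bit b) (bit (a zero) * bit y₀) ⟩
  (bit (a zero) * bit y₀ + rest) + bit b                  ∎
  where
  open import Relation.Binary.Reasoning.Setoid (≅-setoid 2)
  rest : ℤ
  rest = sum (λ j → bit (a (suc j)) * bit (lookup y j))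
  rotate : ∀ p q s → p + (q + s) ≡ (s + p) + q
  rotate = solve-∀

affine-xor : ∀ {r} (a a′ : Fin r → Bool) b b′ y →
  affine a b y xor affine a′ b′ y ≡ affine (λ j → a j xor a′ j) (b xor b′) y
affine-xor a a′ b b′ []       = refl
affine-xor a a′ b b′ (y₀ ∷ y) =
  trans (affine-xor (a ∘ suc) (a′ ∘ suc) (b xor (a zero ∧ y₀)) (b′ xor (a′ zero ∧ y₀)) y)
        (cong (λ t → affine (λ j → a (suc j) xor a′ (suc j)) t y) (regroup b b′ (a zero) (a′ zero) y₀))
  where
  open Bool.xor-∧-Solver
  regroup : ∀ b b′ a a′ y → (b xor (a ∧ y)) xor (b′ xor (a′ ∧ y)) ≡ (b xor b′) xor ((a xor a′) ∧ y)
  regroup = solve 5 (λ b b′ a a′ y → (b :+ (a :* y)) :+ (b′ :+ (a′ :* y)) := (b :+ b′) :+ ((a :+ a′) :* y)) refl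

affine-⊥ : ∀ {r} (a : Fin r → Bool) b → affine a b ⊥ ≡ b
affine-⊥ {zero}  a b = refl
affine-⊥ {suc r} a b = trans (affine-⊥ (a ∘ suc) (b xor (a zero ∧ false))) (simplify b (a zero))
  where
  simplify : ∀ b t → b xor (t ∧ false) ≡ b
  simplify false false = refl
  simplify false true  = refl
  simplify true  false = refl
  simplify true  true  = refl

affine-⁅⁆ : ∀ {r} (a : Fin r → Bool) b j → affine a b ⁅ j ⁆ ≡ b xor a j
affine-⁅⁆ a b zero    = trans (affine-⊥ (a ∘ suc) (b xor (a zero ∧ true))) (simplify b (a zero))
  where
  simplify : ∀ b t → b xor (t ∧ true) ≡ b xor t
  simplify b false = refl
  simplify b true  = refl
affine-⁅⁆ a b (suc j) = trans (affine-⁅⁆ (a ∘ suc) (b xor (a zero ∧ false)) j)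
  (simplify b (a zero) (a (suc j)))
  where
  simplify : ∀ b t s → (b xor (t ∧ false)) xor s ≡ b xor s
  simplify false false s = refl
  simplify false true  s = refl
  simplify true  false s = refl
  simplify true  true  s = refl

-- weight k * ratio k is 0 for k = 0 and (-2)^(k-1) otherwise

ratio : ℕ → ℤ
ratio 0 = + 0
ratio 1 = + 1
ratio 2 = - + 1
ratio 3 = + 1
ratio (suc (suc (suc (suc k)))) = - + 2 * ratio (suc (suc (suc k)))

-- Coefficientwise form of the factor 1 - 2X in `monomials-∷`: δ₀ contributes the 1, the other term
-- contributes -2X.
weight*ratio-suc : ∀ k → weight (suc k) * ratio (suc k) ≡ δ₀ k + - + 2 * (weight k * ratio k)
weight*ratio-suc 0 = refl
weight*ratio-suc 1 = refl
weight*ratio-suc 2 = refl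
weight*ratio-suc (suc (suc (suc k))) = exchange (ratio (suc (suc (suc k))))
  where
  exchange : ∀ t → + 4 * (- + 2 * t) ≡ + 0 + - + 2 * (+ 4 * t)
  exchange = solve-∀

∏∈-⊥ : ∀ {r} (v : Fin r → ℤ) → ∏∈ ⊥ v ≡ + 1
∏∈-⊥ {zero}  v = refl
∏∈-⊥ {suc r} v = trans (ℤ.*-identityˡ _) (∏∈-⊥ (v ∘ suc))

-- This is (1 - ∏ⱼ (1 - 2aⱼyⱼ)) / 2 multiplied out, that is, the parity of Σ aⱼyⱼ as an integer
-- polynomial.
monomials : ∀ {r} → (Fin r → Bool) → Bits r → ℤ
monomials a = poly (λ S → weight ∣ S ∣ * ratio ∣ S ∣ * ∏∈ S (bit ∘ a))

-- With X for the polynomial in the remaining variables and X′ for the whole one, this is 1 - 2X′ =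
-- (1 - 2a₀y₀)(1 - 2X) solved for X′.
monomials-∷ : ∀ {r} (a : Fin (suc r) → Bool) y₀ y →
  monomials a (y₀ ∷ y) ≡
  monomials (a ∘ suc) y + bit y₀ * (bit (a zero) * (+ 1 + - + 2 * monomials (a ∘ suc) y))
monomials-∷ {r} a y₀ y = trans (poly-∷ (λ S → weight ∣ S ∣ * ratio ∣ S ∣ * ∏∈ S (bit ∘ a)) y₀ y)
  (cong₂ (λ p q → p + bit y₀ * q)
    (poly-cong (λ S → cong (weight ∣ S ∣ * ratio ∣ S ∣ *_) (ℤ.*-identityˡ (Π S))) y)
    inside-part)
  where
  open ≡-Reasoning
  Π : Subset r → ℤ
  Π S = ∏∈ S (bit ∘ a ∘ suc)
  distribute : ∀ d w p q → (d + - + 2 * w) * (p * q) ≡ p * (d * q + - + 2 * (w * q))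
  distribute = solve-∀
  inside-part : poly (λ S → weight (suc ∣ S ∣) * ratio (suc ∣ S ∣) * (bit (a zero) * Π S)) y ≡
                bit (a zero) * (+ 1 + - + 2 * monomials (a ∘ suc) y)
  inside-part = begin
    poly (λ S → weight (suc ∣ S ∣) * ratio (suc ∣ S ∣) * (bit (a zero) * Π S)) y
      ≡⟨ poly-cong (λ S → trans (cong (_* (bit (a zero) * Π S)) (weight*ratio-suc ∣ S ∣))
                                (distribute (δ₀ ∣ S ∣) (weight ∣ S ∣ * ratio ∣ S ∣) (bit (a zero)) (Π S))) y ⟩
    poly (λ S → bit (a zero) * (δ₀ ∣ S ∣ * Π S + - + 2 * (weight ∣ S ∣ * ratio ∣ S ∣ * Π S))) y
      ≡⟨ poly-*ˡ (bit (a zero)) _ y ⟩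
    bit (a zero) * poly (λ S → δ₀ ∣ S ∣ * Π S + - + 2 * (weight ∣ S ∣ * ratio ∣ S ∣ * Π S)) y
      ≡⟨ cong (bit (a zero) *_) (poly-+ (λ S → δ₀ ∣ S ∣ * Π S) _ y) ⟩
    bit (a zero) * (poly (λ S → δ₀ ∣ S ∣ * Π S) y + poly (λ S → - + 2 * (weight ∣ S ∣ * ratio ∣ S ∣ * Π S)) y)
      ≡⟨ cong (bit (a zero) *_) (cong₂ _+_ (trans (poly-δ₀ Π y) (∏∈-⊥ (bit ∘ a ∘ suc)))
                                           (poly-*ˡ (- + 2) (λ S → weight ∣ S ∣ * ratio ∣ S ∣ * Π S) y)) ⟩
    bit (a zero) * (+ 1 + - + 2 * monomials (a ∘ suc) y) ∎

bit-affine-monomials : ∀ {r} (a : Fin r → Bool) b y → bit (affine a b y) ≡ bit b + sgn b * monomials a y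
bit-affine-monomials a b []       =
  sym (trans (cong (_+_ (bit b)) (ℤ.*-zeroʳ (sgn b))) (ℤ.+-identityʳ (bit b)))
bit-affine-monomials {suc r} a b (y₀ ∷ y) = begin
  bit (affine (a ∘ suc) (b xor t) y)
    ≡⟨ bit-affine-monomials (a ∘ suc) (b xor t) y ⟩
  bit (b xor t) + sgn (b xor t) * X
    ≡⟨ cong (λ z → z + (+ 1 + - (+ 2 * z)) * X)
         (trans (bit-xor b t) (cong (λ z → bit b + sgn b * z) (bit-∧ (a zero) y₀))) ⟩
  (bit b + sgn b * (bit (a zero) * bit y₀)) + (+ 1 + - (+ 2 * (bit b + sgn b * (bit (a zero) * bit y₀)))) * X
    -- The sign is multiplicative: 1 - 2(b + (1 - 2b)a₀y₀) = (1 - 2b)(1 - 2a₀y₀). The identity holds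
    -- for arbitrary integers, not just for bits.
    ≡⟨ expand (bit b) (bit (a zero)) (bit y₀) X ⟩
  bit b + sgn b * (X + bit y₀ * (bit (a zero) * (+ 1 + - + 2 * X)))
    ≡⟨ cong (λ z → bit b + sgn b * z) (monomials-∷ a y₀ y) ⟨
  bit b + sgn b * monomials a (y₀ ∷ y) ∎
  where
  open ≡-Reasoning
  t : Bool
  t = a zero ∧ y₀
  X : ℤ
  X = monomials (a ∘ suc) y
  expand : ∀ b a y X →
    (b + (+ 1 + - (+ 2 * b)) * (a * y)) + (+ 1 + - (+ 2 * (b + (+ 1 + - (+ 2 * b)) * (a * y)))) * X ≡
    b + (+ 1 + - (+ 2 * b)) * (X + y * (a * (+ 1 + - + 2 * X)))
  expand = solve-∀

-- Functions of the form constant + exponent d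

exponent-+ : ∀ {r} (c d : Subset r → ℤ) y → exponent (λ S → c S + d S) y ≡ exponent c y + exponent d y
exponent-+ c d y = begin
  exponent (λ S → c S + d S) y
    ≡⟨ exponent≡poly (λ S → c S + d S) y ⟩
  poly (λ S → weight ∣ S ∣ * (c S + d S)) y
    ≡⟨ poly-cong (λ S → ℤ.*-distribˡ-+ (weight ∣ S ∣) (c S) (d S)) y ⟩
  poly (λ S → weight ∣ S ∣ * c S + weight ∣ S ∣ * d S) y
    ≡⟨ poly-+ (λ S → weight ∣ S ∣ * c S) _ y ⟩
  poly (λ S → weight ∣ S ∣ * c S) y + poly (λ S → weight ∣ S ∣ * d S) y
    ≡⟨ cong₂ _+_ (exponent≡poly c y) (exponent≡poly d y) ⟨
  exponent c y + exponent d y ∎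
  where open ≡-Reasoning

exponent-*ˡ : ∀ {r} k (c : Subset r → ℤ) y → exponent (λ S → k * c S) y ≡ k * exponent c y
exponent-*ˡ k c y = begin
  exponent (λ S → k * c S) y
    ≡⟨ exponent≡poly (λ S → k * c S) y ⟩
  poly (λ S → weight ∣ S ∣ * (k * c S)) y
    ≡⟨ poly-cong (λ S → x∙yz≈y∙xz (weight ∣ S ∣) k (c S)) y ⟩
  poly (λ S → k * (weight ∣ S ∣ * c S)) y
    ≡⟨ poly-*ˡ k _ y ⟩
  k * poly (λ S → weight ∣ S ∣ * c S) y
    ≡⟨ cong (k *_) (exponent≡poly c y) ⟨
  k * exponent c y ∎
  where
  open ≡-Reasoning

infix 4 _∼_

-- The constant stays out of the type because a constant in the exponent of α only changes the
-- scalar in front; the coefficients d carry all that decides membership in 𝒜.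
record _∼_ {r} (F : Bits r → ℤ) (d : Subset r → ℤ) : Set where
  constructor expansion
  field
    constant : ℤ
    expand   : ∀ y → F y ≡ constant + exponent d y

∼-resp : ∀ {r} {F G : Bits r → ℤ} {d} → (∀ y → F y ≡ G y) → F ∼ d → G ∼ d
∼-resp F≗G (expansion K eq) = expansion K λ y → trans (sym (F≗G y)) (eq y)

∼-exponent : ∀ {r} (d : Subset r → ℤ) → exponent d ∼ d
∼-exponent d = expansion (+ 0) λ y → sym (ℤ.+-identityˡ (exponent d y))

∼-+ : ∀ {r} {F G : Bits r → ℤ} {d e} → F ∼ d → G ∼ e → (λ y → F y + G y) ∼ (λ S → d S + e S)
∼-+ {d = d} {e} (expansion K eq) (expansion K′ eq′) = expansion (K + K′) λ y →
  trans (cong₂ _+_ (eq y) (eq′ y))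
    (trans (+-interchange K (exponent d y) K′ (exponent e y)) (cong (_+_ (K + K′)) (sym (exponent-+ d e y))))

∼-*ˡ : ∀ {r} {F : Bits r → ℤ} {d} k → F ∼ d → (λ y → k * F y) ∼ (λ S → k * d S)
∼-*ˡ {d = d} k (expansion K eq) = expansion (k * K) λ y →
  trans (cong (k *_) (eq y))
    (trans (ℤ.*-distribˡ-+ k K (exponent d y)) (cong (_+_ (k * K)) (sym (exponent-*ˡ k d y))))

∼-zero : ∀ {r} → (λ (y : Bits r) → + 0) ∼ (λ S → + 0)
∼-zero {r} = ∼-resp (λ y → refl) (∼-*ˡ (+ 0) (∼-exponent {r} (λ _ → + 0)))

∼-sum : ∀ {r n} {F : Fin n → Bits r → ℤ} {d : Fin n → Subset r → ℤ} → (∀ i → F i ∼ d i) →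
        (λ y → sum λ i → F i y) ∼ (λ S → sum λ i → d i S)
∼-sum {n = zero}  F∼d = ∼-zero
∼-sum {n = suc n} F∼d = ∼-+ (F∼d zero) (∼-sum (F∼d ∘ suc))

-- The coefficient of bit (b ⊕ a·y) with its weight divided out, since `exponent` multiplies by the
-- weight again.
affineCoeff : ∀ {r} → (Fin r → Bool) → Bool → Subset r → ℤ
affineCoeff a b S = ratio ∣ S ∣ * (sgn b * ∏∈ S (bit ∘ a))

∼-affine : ∀ {r} (a : Fin r → Bool) b → (λ y → bit (affine a b y)) ∼ affineCoeff a b
∼-affine a b = expansion (bit b) λ y → trans (bit-affine-monomials a b y)
  (cong (_+_ (bit b)) (sym (begin
    exponent (affineCoeff a b) y
      ≡⟨ exponent≡poly (affineCoeff a b) y ⟩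
    poly (λ S → weight ∣ S ∣ * (ratio ∣ S ∣ * (sgn b * ∏∈ S (bit ∘ a)))) y
      ≡⟨ poly-cong (λ S → exchange (weight ∣ S ∣) (ratio ∣ S ∣) (sgn b) (∏∈ S (bit ∘ a))) y ⟩
    poly (λ S → sgn b * (weight ∣ S ∣ * ratio ∣ S ∣ * ∏∈ S (bit ∘ a))) y
      ≡⟨ poly-*ˡ (sgn b) _ y ⟩
    sgn b * monomials a y ∎)))
  where
  open ≡-Reasoning
  exchange : ∀ p q s t → p * (q * (s * t)) ≡ s * (p * q * t)
  exchange = solve-∀

2*bit*bit : ∀ p q → + 2 * (bit p * bit q) ≡ bit p + bit q + - + 1 * bit (p xor q)
2*bit*bit false false = refl
2*bit*bit false true  = refl
2*bit*bit true  false = refl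
2*bit*bit true  true  = refl

-- The factor 2 is essential: the product of two distinct variables by itself has coefficient 1 in
-- degree 2, where the weight demands an even one. In 𝒜 the factor is supplied by 2Q′.
∼-affine-product : ∀ {r} (a a′ : Fin r → Bool) b b′ →
  ∃ λ d → (λ y → + 2 * (bit (affine a b y) * bit (affine a′ b′ y))) ∼ d
∼-affine-product a a′ b b′ = _ , ∼-resp
  (λ y → sym (trans (2*bit*bit (affine a b y) (affine a′ b′ y))
    (cong (λ t → bit (affine a b y) + bit (affine a′ b′ y) + - + 1 * bit t) (affine-xor a a′ b b′ y))))
  (∼-+ (∼-+ (∼-affine a b) (∼-affine a′ b′))
       (∼-*ˡ (- + 1) (∼-affine (λ j → a j xor a′ j) (b xor b′))))

-- Membership in 𝒜 may be witnessed in other free variables than those of f. Their values u are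
-- affine in y, so the phase can be rewritten in y. Nothing is claimed about the parity of d:
-- evenness will come from i = α².
∼-quadratic-phase : ∀ {r n} (L′ : Fin n → ℤ) (Q′ : Fin n → Fin n → ℤ)
  (A : Fin n → Fin r → Bool) (B : Fin n → Bool) (u : Bits r → Bits n) →
  (∀ y i → lookup (u y) i ≡ affine (A i) (B i) y) →
  ∃ λ d → (λ y → linear L′ (u y) + + 2 * quadratic Q′ (u y)) ∼ d
∼-quadratic-phase {r} {n} L′ Q′ A B u u-affine = _ , ∼-+ linear-part quadratic-part
  where
  linear-part : (λ y → linear L′ (u y)) ∼ _
  linear-part = ∼-sum λ i → ∼-*ˡ (L′ i) (∼-resp (λ y → cong bit (sym (u-affine y i))) (∼-affine (A i) (B i)))

  monomial : Fin n → Fin n → Bits r → ℤ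
  monomial i j y = if does (i <? j) then Q′ i j * (bit (lookup (u y) i) * bit (lookup (u y) j)) else + 0

  ∼-monomial : ∀ i j → ∃ λ d → (λ y → + 2 * monomial i j y) ∼ d
  ∼-monomial i j with does (i <? j)
  ... | false = _ , ∼-zero
  ... | true  = _ , ∼-resp
    (λ y → trans (cong₂ (λ p q → Q′ i j * (+ 2 * (bit p * bit q))) (sym (u-affine y i)) (sym (u-affine y j)))
                 (x∙yz≈y∙xz (Q′ i j) (+ 2) _))
    (∼-*ˡ (Q′ i j) (proj₂ (∼-affine-product (A i) (A j) (B i) (B j))))

  quadratic-part : (λ y → + 2 * quadratic Q′ (u y)) ∼ _
  quadratic-part = ∼-resp
    (λ y → trans (sum-cong-≗ (λ i → sym (*-distribˡ-sum (+ 2) (λ j → monomial i j y))))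
                 (sym (*-distribˡ-sum (+ 2) (λ i → sum (λ j → monomial i j y)))))
    (∼-sum λ i → ∼-sum λ j → proj₂ (∼-monomial i j))

-- Evenness of the coefficients

Even⁺ : ∀ {r} → (Subset r → ℤ) → Set
Even⁺ d = ∀ S → 1 ≤ ∣ S ∣ → d S ≅ + 0 [ 2 ]

-- Halving gives 2(L′ + 2Q′ + 4H′), and 8H′ vanishes modulo 8. So all terms of degree at least 3
-- disappear, as the definition of 𝒜 requires.
even⇒quadratic-phase : ∀ {r} (d : Subset r → ℤ) → Even⁺ d →
  ∃ λ L′ → ∃ λ Q′ → ∀ y → exponent d y ≅ + 2 * (linear L′ y + + 2 * quadratic Q′ y) [ 8 ]
even⇒quadratic-phase d even = (λ j → h ⁅ j ⁆) , (λ j k → h (⁅ j ⁆ ∪ ⁅ k ⁆)) , λ y →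
  congruent (higher h y) (begin
    exponent d y                                  ≡⟨ exponent≡poly d y ⟩
    poly (λ S → weight ∣ S ∣ * d S) y             ≡⟨ poly-cong weight*d y ⟩
    poly (λ S → weight ∣ S ∣ * (+ 2 * h S)) y     ≡⟨ exponent≡poly (λ S → + 2 * h S) y ⟨
    exponent (λ S → + 2 * h S) y                  ≡⟨ exponent-*ˡ (+ 2) h y ⟩
    + 2 * exponent h y
      ≡⟨ split (linear (λ j → h ⁅ j ⁆) y + + 2 * quadratic (λ j k → h (⁅ j ⁆ ∪ ⁅ k ⁆)) y) (higher h y) ⟩
    _ ∎)
  where
  open ≡-Reasoning
  split : ∀ p q → + 2 * (p + + 4 * q) ≡ + 2 * p + q * + 8
  split = solve-∀
  h : Subset _ → ℤ
  h S with 1 ℕ.≤? ∣ S ∣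
  ... | yes S≢⊥ = _≅_[_].quotient (even S S≢⊥)
  -- The value at the empty set is arbitrary, because its weight is 0.
  ... | no _    = + 0
  weight*d : ∀ S → weight ∣ S ∣ * d S ≡ weight ∣ S ∣ * (+ 2 * h S)
  weight*d S with 1 ℕ.≤? ∣ S ∣
  ... | yes S≢⊥ = cong (weight ∣ S ∣ *_) (trans (_≅_[_].equation (even S S≢⊥))
                    (trans (ℤ.+-identityˡ _) (ℤ.*-comm (_≅_[_].quotient (even S S≢⊥)) (+ 2))))
  ... | no S≡⊥  = trans (cong (_* d S) weight≡0) (sym (cong (_* (+ 2 * + 0)) weight≡0))
    where
    weight≡0 : weight ∣ S ∣ ≡ + 0
    weight≡0 = cong weight (ℕ.n≤0⇒n≡0 (ℕ.≤-pred (ℕ.≰⇒> S≡⊥)))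

-- For k ≥ 1 the weight divides 4, so cancelling it leaves an even modulus: 8, 4 or 2. The witnesses
-- 4q, 2q, q are half that modulus times q.
even-cancel-weight : ∀ k {d e} → 1 ≤ k → weight k * (d + - + 2 * e) ≅ + 0 [ 8 ] → d ≅ + 0 [ 2 ]
even-cancel-weight 1 {d} {e} _ (congruent q eq) = congruent (e + + 4 * q)
  (trans (add d e) (trans (cong (_+ + 2 * e) eq) (collect e q)))
  where
  add : ∀ d e → d ≡ + 1 * (d + - + 2 * e) + + 2 * e
  add = solve-∀
  collect : ∀ e q → + 0 + q * + 8 + + 2 * e ≡ + 0 + (e + + 4 * q) * + 2
  collect = solve-∀
even-cancel-weight 2 {d} {e} _ (congruent q eq) = congruent (e + + 2 * q)
  (ℤ.*-cancelˡ-≡ (+ 2) _ _ (trans (add d e) (trans (cong (_+ + 4 * e) eq) (collect e q))))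
  where
  add : ∀ d e → + 2 * d ≡ + 2 * (d + - + 2 * e) + + 4 * e
  add = solve-∀
  collect : ∀ e q → + 0 + q * + 8 + + 4 * e ≡ + 2 * (+ 0 + (e + + 2 * q) * + 2)
  collect = solve-∀
even-cancel-weight (suc (suc (suc _))) {d} {e} _ (congruent q eq) = congruent (e + q)
  (ℤ.*-cancelˡ-≡ (+ 4) _ _ (trans (add d e) (trans (cong (_+ + 8 * e) eq) (collect e q))))
  where
  add : ∀ d e → + 4 * d ≡ + 4 * (d + - + 2 * e) + + 8 * e
  add = solve-∀
  collect : ∀ e q → + 0 + q * + 8 + + 8 * e ≡ + 4 * (+ 0 + (e + q) * + 2)
  collect = solve-∀

-- The hypothesis says that F - 2G is constant modulo 8. Uniqueness of coefficients then makes the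
-- weighted difference of d and 2e vanish modulo 8 at every nonempty set.
quadratic-phase⇒even : ∀ {r} {F G : Bits r → ℤ} {d e} → F ∼ d → G ∼ e →
  (∀ y z → F y + + 2 * G z ≅ F z + + 2 * G y [ 8 ]) → Even⁺ d
quadratic-phase⇒even {r} {F} {G} {d} {e} (expansion K F≡) (expansion K′ G≡) ratio-const S S≢⊥ =
  even-cancel-weight ∣ S ∣ {e = e S} S≢⊥ (coefficient S S≢⊥)
  where
  C : Subset r → ℤ
  C S = d S + - + 2 * e S

  κ : ℤ
  κ = exponent C ⊥

  exponent-C : ∀ y → exponent C y ≡ exponent d y + - + 2 * exponent e y
  exponent-C y = trans (exponent-+ d (λ S → - + 2 * e S) y) (cong (_+_ (exponent d y)) (exponent-*ˡ (- + 2) e y))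

  constant : ∀ y → exponent C y ≅ κ [ 8 ]
  constant y with ratio-const y ⊥
  ... | congruent q eq = congruent q (trans (exponent-C y) (trans
    (rearrange (exponent d y) (exponent e y) (exponent d ⊥) (exponent e ⊥) K K′ (q * + 8)
      (trans (sym (cong₂ (λ s t → s + + 2 * t) (F≡ y) (G≡ ⊥)))
        (trans eq (cong₂ (λ s t → s + + 2 * t + q * + 8) (F≡ ⊥) (G≡ y)))))
    (cong (_+ q * + 8) (sym (exponent-C ⊥)))))
    where
    rearrange : ∀ dy ey d₀ e₀ K K′ m → (K + dy) + + 2 * (K′ + e₀) ≡ (K + d₀) + + 2 * (K′ + ey) + m →
      dy + - + 2 * ey ≡ d₀ + - + 2 * e₀ + m
    rearrange dy ey d₀ e₀ K K′ m eq =
      trans (lhs dy ey e₀ K K′)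
        (trans (cong (_+ (- K + - + 2 * (K′ + e₀) + - + 2 * ey)) eq) (rhs ey d₀ e₀ K K′ m))
      where
      lhs : ∀ dy ey e₀ K K′ → dy + - + 2 * ey ≡
            (K + dy) + + 2 * (K′ + e₀) + (- K + - + 2 * (K′ + e₀) + - + 2 * ey)
      lhs = solve-∀
      rhs : ∀ ey d₀ e₀ K K′ m → (K + d₀) + + 2 * (K′ + ey) + m + (- K + - + 2 * (K′ + e₀) + - + 2 * ey) ≡
            d₀ + - + 2 * e₀ + m
      rhs = solve-∀

  -- Subtracting κ at the empty set gives a polynomial that vanishes modulo 8 at every point, and
  -- leaves the coefficients of nonempty sets untouched.
  D : Subset r → ℤ
  D S = weight ∣ S ∣ * C S + δ₀ ∣ S ∣ * - κ

  vanish : ∀ y → poly D y ≅ + 0 [ 8 ]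
  vanish y = begin
    poly D y                 ≡⟨ poly-+ (λ S → weight ∣ S ∣ * C S) (λ S → δ₀ ∣ S ∣ * - κ) y ⟩
    poly (λ S → weight ∣ S ∣ * C S) y + poly (λ S → δ₀ ∣ S ∣ * - κ) y
                             ≡⟨ cong₂ _+_ (sym (exponent≡poly C y)) (poly-δ₀ (λ _ → - κ) y) ⟩
    exponent C y + - κ       ≈⟨ +-cong-≅ (constant y) (≡⇒≅ { - κ} refl) ⟩
    κ + - κ                  ≡⟨ ℤ.+-inverseʳ κ ⟩
    + 0                      ∎
    where open import Relation.Binary.Reasoning.Setoid (≅-setoid 8)

  δ₀-zero : ∀ k → 1 ≤ k → ∀ p → p + δ₀ k * - κ ≡ p
  δ₀-zero (suc k) _ p = ℤ.+-identityʳ p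

  coefficient : ∀ S → 1 ≤ ∣ S ∣ → weight ∣ S ∣ * C S ≅ + 0 [ 8 ]
  coefficient S S≢⊥ = ≅-trans (≡⇒≅ (sym (δ₀-zero ∣ S ∣ S≢⊥ (weight ∣ S ∣ * C S)))) (poly-coefficients D vanish S)

-- Parities

ratio-odd : ∀ k → 1 ≤ k → k ≤ 3 → ratio k ≅ + 1 [ 2 ]
ratio-odd 1 _ _ = ≡⇒≅ refl
ratio-odd 2 _ _ = congruent (- + 1) refl
ratio-odd 3 _ _ = ≡⇒≅ refl
ratio-odd (suc (suc (suc (suc k)))) _ k≤3 = contradiction k≤3 (ℕ.m+n≮m 3 k)

ratio-even : ∀ k → 4 ≤ k → ratio k ≅ + 0 [ 2 ]
ratio-even (suc (suc (suc (suc k)))) _ = congruent (- ratio (3 ℕ.+ k)) (exchange (ratio (3 ℕ.+ k)))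
  where
  exchange : ∀ t → - + 2 * t ≡ + 0 + - t * + 2
  exchange = solve-∀
ratio-even 0 ()
ratio-even 1 (s≤s ())
ratio-even 2 (s≤s (s≤s ()))
ratio-even 3 (s≤s (s≤s (s≤s ())))

-- Bits are idempotent, so j may already belong to S. This is where a factor σᵢ raises the degree,
-- by at most one.
∏∈-insert : ∀ {r} (a : Fin r → Bool) S j → bit (a j) * ∏∈ S (bit ∘ a) ≡ ∏∈ (S [ j ]≔ inside) (bit ∘ a)
∏∈-insert a (outside ∷ S) zero = cong (bit (a zero) *_) (ℤ.*-identityˡ (∏∈ S (bit ∘ a ∘ suc)))
∏∈-insert a (inside ∷ S)  zero = idempotent (a zero)
  where
  idempotent : ∀ t {p} → bit t * (bit t * p) ≡ bit t * p
  idempotent false     = refl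
  idempotent true  {p} = ℤ.*-identityˡ (+ 1 * p)
∏∈-insert a (s ∷ S) (suc j) = trans (x∙yz≈y∙xz (bit (a (suc j))) (if s then bit (a zero) else + 1) (∏∈ S (bit ∘ a ∘ suc)))
  (cong ((if s then bit (a zero) else + 1) *_) (∏∈-insert (a ∘ suc) S j))

∣insert∣-lower : ∀ {r} (S : Subset r) j → 1 ≤ ∣ S [ j ]≔ inside ∣
∣insert∣-lower (_ ∷ S)       zero    = s≤s z≤n
∣insert∣-lower (outside ∷ S) (suc j) = ∣insert∣-lower S j
∣insert∣-lower (inside ∷ S)  (suc j) = s≤s z≤n

∣insert∣-upper : ∀ {r} (S : Subset r) j → ∣ S [ j ]≔ inside ∣ ≤ suc ∣ S ∣
∣insert∣-upper (outside ∷ S) zero    = ℕ.≤-refl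
∣insert∣-upper (inside ∷ S)  zero    = ℕ.n≤1+n _
∣insert∣-upper (outside ∷ S) (suc j) = ∣insert∣-upper S j
∣insert∣-upper (inside ∷ S)  (suc j) = s≤s (∣insert∣-upper S j)

-- Used with k = 2, to reach the congruences for |S| ≤ 4 from information about nonempty sets of
-- size at most 3.
insert-surjective : ∀ {r} k (S : Subset r) → 1 ≤ ∣ S ∣ → ∣ S ∣ ≤ suc (suc k) →
  ∃ λ S′ → ∃ λ j → 1 ≤ ∣ S′ ∣ × ∣ S′ ∣ ≤ suc k × S′ [ j ]≔ inside ≡ S
insert-surjective k (outside ∷ S) 1≤ ≤k with insert-surjective k S 1≤ ≤k
... | S′ , j , 1≤′ , ≤k′ , eq = outside ∷ S′ , suc j , 1≤′ , ≤k′ , cong (outside ∷_) eq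
insert-surjective k (inside ∷ S) _ (s≤s ≤k) with 1 ℕ.≤? ∣ S ∣
... | yes 1≤ = outside ∷ S , zero , 1≤ , ≤k , refl
-- A singleton must not lose its element, as S′ has to be nonempty; it is obtained by inserting an
-- element that it already has.
... | no 1≰  = inside ∷ S , zero , s≤s z≤n , s≤s (ℕ.≤-trans (ℕ.≤-pred (ℕ.≰⇒> 1≰)) z≤n) , refl

module Parity {n r} (a : Fin n → Fin r → Bool) (b : Fin n → Bool) (c : Subset r → ℤ) where

  T U : Subset r → ℤ
  T S = sum (λ i → ∏∈ S (bit ∘ a i))
  U S = sum (λ i → ∏∈ S (bit ∘ a i) * bit (b i))

  twisted : (Fin n → Bool) → Subset r → ℤ
  twisted σ S = c S + sum (λ i → bit (σ i) * affineCoeff (a i) (b i) S)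

  σ⟨_⟩ : Bits r → Fin n → Bool
  σ⟨ s ⟩ i = affine (a i) (b i) s

  Σσ : (Fin n → Bool) → Subset r → ℤ
  Σσ σ S = sum (λ i → bit (σ i) * ∏∈ S (bit ∘ a i))

  twisted-small : ∀ σ S → 1 ≤ ∣ S ∣ → ∣ S ∣ ≤ 3 → twisted σ S ≅ c S + Σσ σ S [ 2 ]
  twisted-small σ S 1≤ ≤3 = +-congˡ-≅ (c S) (sum-cong-≅ λ i → *-congˡ-≅ (bit (σ i)) (begin
    ratio ∣ S ∣ * (sgn (b i) * ∏∈ S (bit ∘ a i))
      ≈⟨ *-cong-≅ (ratio-odd ∣ S ∣ 1≤ ≤3) (*-congʳ-≅ (∏∈ S (bit ∘ a i)) (sgn≅1 (b i))) ⟩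
    + 1 * (+ 1 * ∏∈ S (bit ∘ a i))
      ≡⟨ trans (ℤ.*-identityˡ _) (ℤ.*-identityˡ _) ⟩
    ∏∈ S (bit ∘ a i) ∎))
    where open import Relation.Binary.Reasoning.Setoid (≅-setoid 2)

  twisted-large : ∀ σ S → 4 ≤ ∣ S ∣ → twisted σ S ≅ c S [ 2 ]
  twisted-large σ S 4≤ = begin
    c S + sum (λ i → bit (σ i) * affineCoeff (a i) (b i) S)
      ≈⟨ +-congˡ-≅ (c S) (sum-cong-≅ λ i → ≅-trans
           (*-congˡ-≅ (bit (σ i)) (*-congʳ-≅ (sgn (b i) * ∏∈ S (bit ∘ a i)) (ratio-even ∣ S ∣ 4≤)))
           (≡⇒≅ (ℤ.*-zeroʳ (bit (σ i))))) ⟩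
    c S + sum {n} (λ _ → + 0)
      ≡⟨ trans (cong (_+_ (c S)) (sum-replicate-zero n)) (ℤ.+-identityʳ (c S)) ⟩
    c S ∎
    where open import Relation.Binary.Reasoning.Setoid (≅-setoid 2)

  -- At the origin of the free coordinates σᵢ = bᵢ, and at the j-th unit vector σᵢ = bᵢ ⊕ aᵢⱼ. These
  -- points already separate U from T, which suffices for necessity; sufficiency needs `Σσ⟨⟩` at
  -- every s.
  Σσ⟨⊥⟩ : ∀ S → Σσ σ⟨ ⊥ ⟩ S ≡ U S
  Σσ⟨⊥⟩ S = sum-cong-≗ λ i → trans (ℤ.*-comm (bit (affine (a i) (b i) ⊥)) (∏∈ S (bit ∘ a i)))
    (cong (λ t → ∏∈ S (bit ∘ a i) * bit t) (affine-⊥ (a i) (b i)))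

  Σσ⟨⁅⁆⟩ : ∀ j S → Σσ σ⟨ ⁅ j ⁆ ⟩ S ≅ U S + T (S [ j ]≔ inside) [ 2 ]
  Σσ⟨⁅⁆⟩ j S = ≅-trans
    (sum-cong-≅ λ i → begin
      bit (affine (a i) (b i) ⁅ j ⁆) * ∏∈ S (bit ∘ a i)
        ≡⟨ cong (λ t → bit t * ∏∈ S (bit ∘ a i)) (affine-⁅⁆ (a i) (b i) j) ⟩
      bit (b i xor a i j) * ∏∈ S (bit ∘ a i)
        ≈⟨ *-congʳ-≅ (∏∈ S (bit ∘ a i)) (bit-xor-≅ (b i) (a i j)) ⟩
      (bit (b i) + bit (a i j)) * ∏∈ S (bit ∘ a i)
        ≡⟨ distribute (bit (b i)) (bit (a i j)) (∏∈ S (bit ∘ a i)) ⟩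
      ∏∈ S (bit ∘ a i) * bit (b i) + bit (a i j) * ∏∈ S (bit ∘ a i)
        ≡⟨ cong (_+_ (∏∈ S (bit ∘ a i) * bit (b i))) (∏∈-insert (a i) S j) ⟩
      ∏∈ S (bit ∘ a i) * bit (b i) + ∏∈ (S [ j ]≔ inside) (bit ∘ a i) ∎)
    (≡⇒≅ (∑-distrib-+ (λ i → ∏∈ S (bit ∘ a i) * bit (b i)) (λ i → ∏∈ (S [ j ]≔ inside) (bit ∘ a i))))
    where
    open import Relation.Binary.Reasoning.Setoid (≅-setoid 2)
    distribute : ∀ p q s → (p + q) * s ≡ s * p + q * s
    distribute = solve-∀

  Σσ⟨⟩ : ∀ s S → Σσ σ⟨ s ⟩ S ≅ sum (λ j → bit (lookup s j) * T (S [ j ]≔ inside)) + U S [ 2 ]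
  Σσ⟨⟩ s S = begin
    Σσ σ⟨ s ⟩ S
      ≈⟨ sum-cong-≅ (λ i → *-congʳ-≅ (Π i) (affine-≅ (a i) (b i) s)) ⟩
    sum (λ i → (sum (λ j → bit (a i j) * bit (lookup s j)) + bit (b i)) * Π i)
      ≡⟨ sum-cong-≗ expand ⟩
    sum (λ i → sum (λ j → bit (lookup s j) * Π′ i j) + Π i * bit (b i))
      ≡⟨ ∑-distrib-+ (λ i → sum (λ j → bit (lookup s j) * Π′ i j)) (λ i → Π i * bit (b i)) ⟩
    sum (λ i → sum (λ j → bit (lookup s j) * Π′ i j)) + U S
      ≡⟨ cong (_+ U S) (∑-comm (λ i j → bit (lookup s j) * Π′ i j)) ⟩
    sum (λ j → sum (λ i → bit (lookup s j) * Π′ i j)) + U S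
      ≡⟨ cong (_+ U S) (sum-cong-≗ (λ j → sym (*-distribˡ-sum (bit (lookup s j)) (λ i → Π′ i j)))) ⟩
    sum (λ j → bit (lookup s j) * T (S [ j ]≔ inside)) + U S ∎
    where
    open import Relation.Binary.Reasoning.Setoid (≅-setoid 2)
    Π : Fin n → ℤ
    Π i = ∏∈ S (bit ∘ a i)
    Π′ : Fin n → Fin r → ℤ
    Π′ i j = ∏∈ (S [ j ]≔ inside) (bit ∘ a i)
    exchange : ∀ p q s → p * (q * s) ≡ s * (q * p)
    exchange = solve-∀
    regroup : ∀ i j → Π i * (bit (a i j) * bit (lookup s j)) ≡ bit (lookup s j) * Π′ i j
    regroup i j = trans (exchange (Π i) (bit (a i j)) (bit (lookup s j)))
                        (cong (bit (lookup s j) *_) (∏∈-insert (a i) S j))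
    distribute : ∀ p q s → (p + q) * s ≡ s * p + s * q
    distribute = solve-∀
    expand : ∀ i → (sum (λ j → bit (a i j) * bit (lookup s j)) + bit (b i)) * Π i ≡
                   sum (λ j → bit (lookup s j) * Π′ i j) + Π i * bit (b i)
    expand i = trans (distribute (sum (λ j → bit (a i j) * bit (lookup s j))) (bit (b i)) (Π i))
      (cong (_+ Π i * bit (b i))
        (trans (*-distribˡ-sum (Π i) (λ j → bit (a i j) * bit (lookup s j))) (sum-cong-≗ (regroup i))))

  Conditions : Set
  Conditions =
      (∀ S → 4 ≤ ∣ S ∣ → c S ≡ + 0 [mod 2 ])
    × (∀ S → 1 ≤ ∣ S ∣ → ∣ S ∣ ≤ 4 → T S ≡ + 0 [mod 2 ])
    × (∀ S → 1 ≤ ∣ S ∣ → ∣ S ∣ ≤ 3 → U S ≡ c S [mod 2 ])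

  twisted-even⇒conditions : (∀ s → Even⁺ (twisted σ⟨ s ⟩)) → Conditions
  twisted-even⇒conditions even =
      (λ S 4≤ → ≅⇒mod (≅-trans (≅-sym (twisted-large σ⟨ ⊥ ⟩ S 4≤)) (even ⊥ S (ℕ.≤-trans (s≤s z≤n) 4≤))))
    , (λ S 1≤ ≤4 → ≅⇒mod (T≅0 S 1≤ ≤4))
    , (λ S 1≤ ≤3 → ≅⇒mod (U≅c S 1≤ ≤3))
    where
    small : ∀ s S → 1 ≤ ∣ S ∣ → ∣ S ∣ ≤ 3 → Σσ σ⟨ s ⟩ S ≅ c S [ 2 ]
    small s S 1≤ ≤3 = ≅-opposite (≅-trans (≅-sym (twisted-small σ⟨ s ⟩ S 1≤ ≤3)) (even s S 1≤))
    U≅c : ∀ S → 1 ≤ ∣ S ∣ → ∣ S ∣ ≤ 3 → U S ≅ c S [ 2 ]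
    U≅c S 1≤ ≤3 = ≅-trans (≡⇒≅ (sym (Σσ⟨⊥⟩ S))) (small ⊥ S 1≤ ≤3)
    T≅0 : ∀ S → 1 ≤ ∣ S ∣ → ∣ S ∣ ≤ 4 → T S ≅ + 0 [ 2 ]
    T≅0 S 1≤ ≤4 with insert-surjective 2 S 1≤ ≤4
    ... | S′ , j , 1≤′ , ≤3 , refl = begin
      -- T is the difference of the sums at the unit vector and at the origin; both are congruent to
      -- c S′.
      T (S′ [ j ]≔ inside)                     ≡⟨ isolate (U S′) (T (S′ [ j ]≔ inside)) ⟩
      (U S′ + T (S′ [ j ]≔ inside)) + - U S′   ≈⟨ +-cong-≅ (≅-trans (≅-sym (Σσ⟨⁅⁆⟩ j S′))
                                                    (≅-trans (small ⁅ j ⁆ S′ 1≤′ ≤3) (≅-sym (U≅c S′ 1≤′ ≤3))))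
                                                    (≡⇒≅ { - U S′} refl) ⟩
      U S′ + - U S′                            ≡⟨ ℤ.+-inverseʳ (U S′) ⟩
      + 0                                      ∎
      where
      open import Relation.Binary.Reasoning.Setoid (≅-setoid 2)
      isolate : ∀ p q → q ≡ (p + q) + - p
      isolate = solve-∀

  conditions⇒twisted-even : Conditions → ∀ s → Even⁺ (twisted σ⟨ s ⟩)
  conditions⇒twisted-even (c-large , T-even , U≡c) s S 1≤ with ∣ S ∣ ℕ.≤? 3
  ... | no ≰3  = ≅-trans (twisted-large σ⟨ s ⟩ S (ℕ.≰⇒> ≰3)) (mod⇒≅ (c-large S (ℕ.≰⇒> ≰3)))
  ... | yes ≤3 = begin
    twisted σ⟨ s ⟩ S
      ≈⟨ twisted-small σ⟨ s ⟩ S 1≤ ≤3 ⟩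
    c S + Σσ σ⟨ s ⟩ S
      ≈⟨ +-congˡ-≅ (c S) (Σσ⟨⟩ s S) ⟩
    c S + (sum (λ j → bit (lookup s j) * T (S [ j ]≔ inside)) + U S)
      -- Inserting j into a set of size at most 3 gives size at most 4, the range in which T is
      -- known to be even. What remains is U, congruent to c S, which doubles the c S in front.
      ≈⟨ +-congˡ-≅ (c S) (+-cong-≅
           (sum-cong-≅ λ j → *-congˡ-≅ (bit (lookup s j))
             (mod⇒≅ (T-even (S [ j ]≔ inside) (∣insert∣-lower S j) (ℕ.≤-trans (∣insert∣-upper S j) (s≤s ≤3)))))
           (mod⇒≅ (U≡c S 1≤ ≤3))) ⟩
    c S + (sum (λ j → bit (lookup s j) * + 0) + c S)
      ≡⟨ cong (λ t → c S + (t + c S)) (trans (sum-cong-≗ λ j → ℤ.*-zeroʳ (bit (lookup s j))) (sum-replicate-zero r)) ⟩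
    c S + (+ 0 + c S)
      ≡⟨ cong (_+_ (c S)) (ℤ.+-identityˡ (c S)) ⟩
    c S + c S
      ≈⟨ double-even (c S) ⟩
    + 0 ∎
    where open import Relation.Binary.Reasoning.Setoid (≅-setoid 2)

-- Twisted functions and the class 𝒜

χ-true : ∀ {n} {P : Pred (Bits n) 0ℓ} (P? : Decidable P) x → P x → χ P? x ≡ 1ᶜ
χ-true P? x Px with P? x
... | yes _  = refl
... | no ¬Px = contradiction Px ¬Px

-- On the support both descriptions of g hold, z · α^ψ and μ · α^(2h) with h the phase from 𝒜.
-- Comparing them at two points eliminates μ and shows that ψ - 2h is constant modulo 8.
affineForm⇒even : ∀ {n r} (g : Bits n → ℂ) {z} → z ≉ 0ᶜ →
  (a : Fin n → Fin r → Bool) (b : Fin n → Bool) (point : Bits r → Bits n) →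
  (∀ y → Supp g (point y)) → (∀ y i → lookup (point y) i ≡ affine (a i) (b i) y) →
  ∀ {ψ d} → ψ ∼ d → (∀ y → g (point y) ≈ z · α ^ ψ y) → IsAffineForm g → Even⁺ d
affineForm⇒even {r = r} g {z} z≉0 a b point point∈ coordinate {ψ} ψ∼d g≈ g∈𝒜 =
  quadratic-phase⇒even ψ∼d (proj₂ h∼) λ y y′ → ≅-from-difference (stabilises⇒≅0 {z} z≉0
    ((ψ y + + 2 * h y′) + - (ψ y′ + + 2 * h y))
    (α^.ratio-stabilises {z} {μ} (ψ y) (+ 2 * h y) (ψ y′) (+ 2 * h y′) (agree y) (agree y′)))
  where
  open IsAffineForm g∈𝒜 using (dim; ι; μ; L′; Q′; form)
  u : Bits r → Bits dim
  u y = restrict ι (point y)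
  h : Bits r → ℤ
  h y = linear L′ (u y) + + 2 * quadratic Q′ (u y)
  h∼ : ∃ λ e → h ∼ e
  h∼ = ∼-quadratic-phase L′ Q′ (a ∘ ι) (b ∘ ι) u λ y i →
    trans (lookup∘tabulate (lookup (point y) ∘ ι) i) (coordinate y (ι i))
  agree : ∀ y → z · α ^ ψ y ≈ μ · α ^ (+ 2 * h y)
  agree y = begin
    z · α ^ ψ y             ≈⟨ g≈ y ⟨
    g (point y)             ≈⟨ form (point y) (point∈ y) ⟩
    μ · 𝕚 ^ h y             ≈⟨ ∙-congˡ {μ} {𝕚 ^ h y} {α ^ (+ 2 * h y)} (𝕚^≈α^2* (h y)) ⟩
    μ · α ^ (+ 2 * h y)     ∎
    where
    open CommutativeMonoid ·-commutativeMonoid using (setoid; ∙-congˡ)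
    open import Relation.Binary.Reasoning.Setoid setoid

module Twist {n} (f g : Bits n → ℂ) (t : Bits n → ℤ) (g≈twist : ∀ x → g x ≈ α ^ t x · f x) where

  supp-twist⁺ : ∀ x → Supp f x → Supp g x
  supp-twist⁺ x fx≉0 gx≈0 = fx≉0 (α^·z≈0⇒z≈0 (t x) {f x}
    (≈-trans {α ^ t x · f x} {g x} {0ᶜ} (≈-sym {g x} {α ^ t x · f x} (g≈twist x)) gx≈0))

  supp-twist⁻ : ∀ x → Supp g x → Supp f x
  supp-twist⁻ x gx≉0 fx≈0 = gx≉0 (≈-trans {g x} {α ^ t x · f x} {0ᶜ} (g≈twist x)
    (≈-trans {α ^ t x · f x} {α ^ t x · 0ᶜ} {0ᶜ}
      (·-cong {α ^ t x} {α ^ t x} {f x} {0ᶜ} (≈-refl {α ^ t x}) fx≈0) (·-zeroʳ (α ^ t x))))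

  -- Powers of α are units, so g inherits the support and the free variables of f. The constant K of
  -- the expansion goes into μ.
  even⇒affineForm : ∀ {r} (ι : Fin r → Fin n) → IsAffineSubspace (Supp f) → FreeVariables (Supp f) ι →
    ∀ {z} → z ≉ 0ᶜ → ∀ {ψ d} → ψ ∼ d → (∀ x → Supp f x → g x ≈ z · α ^ ψ (restrict ι x)) →
    Even⁺ d → IsAffineForm g
  even⇒affineForm ι (v₀ , V⊥ , V⊕) free {z} z≉0 {ψ} {d} (expansion K ψ≡) g≈ even =
    let L , Q , exponent≅ = even⇒quadratic-phase d even in record
    { supp-affine = v₀ , supp-twist⁺ (v₀ ⊕ replicate n false) V⊥ , λ x y Vx Vy →
                    supp-twist⁺ (v₀ ⊕ (x ⊕ y)) (V⊕ x y (supp-twist⁻ (v₀ ⊕ x) Vx) (supp-twist⁻ (v₀ ⊕ y) Vy))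
    ; ι           = ι
    ; free        = λ y → let x , (x∈ , x↾≡y) , unique = free y in
                      x , (supp-twist⁺ x x∈ , x↾≡y) , λ {x′} (x′∈ , x′↾≡y) → unique (supp-twist⁻ x′ x′∈ , x′↾≡y)
    ; μ           = z · α ^ K
    ; μ≉0         = λ μ≈0 → z≉0 (α^·z≈0⇒z≈0 K {z}
                      (≈-trans {α ^ K · z} {z · α ^ K} {0ᶜ} (·-comm (α ^ K) z) μ≈0))
    ; L′          = L
    ; Q′          = Q
    ; form        = λ x x∈ → form (restrict ι x) x (linear L (restrict ι x) + + 2 * quadratic Q (restrict ι x))
                      (g≈ x (supp-twist⁻ x x∈))
                      (≅-trans (≡⇒≅ (ψ≡ (restrict ι x))) (+-congˡ-≅ K (exponent≅ (restrict ι x))))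
    }
    where
    form : ∀ y x h → g x ≈ z · α ^ ψ y → ψ y ≅ K + + 2 * h [ 8 ] → g x ≈ z · α ^ K · 𝕚 ^ h
    form y x h g≈ ψ≅ = α^.p-split {g x} {z} {𝕚 ^ h} K (+ 2 * h)
      (≈-trans {g x} {z · α ^ ψ y} {z · α ^ (K + + 2 * h)} g≈
        (·-cong {z} {z} {α ^ ψ y} {α ^ (K + + 2 * h)} (≈-refl {z}) (α^-cong {ψ y} {K + + 2 * h} ψ≅)))
      (𝕚^≈α^2* h)

-- Coordinates on the support and the two implications

theorem3p4 : ∀ {n r : ℕ} (f : Bits n → ℂ) (r≤n : r ≤ n) →
    IsAffineSubspace (Supp f) →
    (free : FreeVariables (Supp f) (λ j → inject≤ j r≤n)) →
    (a : Fin n → Fin r → Bool) (b : Fin n → Bool) →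
    (∀ x → Supp f x → ∀ i →
    bit (lookup x i) ≡ sum (λ j → bit (a i j) * bit (lookup x (inject≤ j r≤n))) + bit (b i) [mod 2 ]) →
    (∀ i j → a (inject≤ i r≤n) j ≡ does (i ≟ j)) →
    (∀ i → b (inject≤ i r≤n) ≡ false) →
    (λ₀ : ℂ) → λ₀ ≉ 0ᶜ →
    (c : Subset r → ℤ) →
    (∀ x → f x ≈ λ₀ · χ (free⇒dec free) x · α ^ exponent c (restrict (λ j → inject≤ j r≤n) x)) →
    f ∈ℒ ⇔
    ((∀ S → 4 ≤ ∣ S ∣ → c S ≡ + 0 [mod 2 ])
    × (∀ S → 1 ≤ ∣ S ∣ → ∣ S ∣ ≤ 4 →
    sum (λ i → ∏∈ S (λ j → bit (a i j))) ≡ + 0 [mod 2 ])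
    × (∀ S → 1 ≤ ∣ S ∣ → ∣ S ∣ ≤ 3 →
    sum (λ i → ∏∈ S (λ j → bit (a i j)) * bit (b i)) ≡ c S [mod 2 ]))
theorem3p4 {n} {r} f r≤n affine-support free a b x-affine _ _ λ₀ λ₀≉0 c f-form = mk⇔
  (λ f∈ℒ → twisted-even⇒conditions λ s →
    ∈𝒜⇒even s _ (λ x → ≈-refl {α ^ twist (point s) x · f x}) (f∈ℒ (point s) (point∈ s)))
  (λ conditions σ σ∈ → inj₂ (Twist.even⇒affineForm f _ (twist σ) (λ x → ≈-refl {α ^ twist σ x · f x})
    ι affine-support free {λ₀} λ₀≉0 (phase∼ (restrict ι σ)) (λ x → twist-phase σ x σ∈)
    (conditions⇒twisted-even conditions (restrict ι σ))))
  where
  open Parity a b c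

  ι : Fin r → Fin n
  ι j = inject≤ j r≤n

  point : Bits r → Bits n
  point y = proj₁ (free y)

  point∈ : ∀ y → Supp f (point y)
  point∈ y = proj₁ (proj₁ (proj₂ (free y)))

  restrict-point : ∀ y → restrict ι (point y) ≡ y
  restrict-point y = proj₂ (proj₁ (proj₂ (free y)))

  coordinate : ∀ x → Supp f x → ∀ i → lookup x i ≡ σ⟨ restrict ι x ⟩ i
  coordinate x x∈ i = ≅-bit-injective (≅-trans (mod⇒≅ (x-affine x x∈ i)) (≅-sym (≅-trans
    (affine-≅ (a i) (b i) (restrict ι x))
    (≡⇒≅ (cong (_+ bit (b i)) (sum-cong-≗ λ j →
      cong (λ t → bit (a i j) * bit t) (lookup∘tabulate (lookup x ∘ ι) j)))))))

  -- Here s holds the free coordinates of σ. For fixed s the bits of σ are constants, so the twist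
  -- is an integer combination of bits of affine forms in y; this gives `phase∼`.
  phase : Bits r → Bits r → ℤ
  phase s y = exponent c y + sum (λ i → bit (σ⟨ s ⟩ i) * bit (σ⟨ y ⟩ i))

  phase∼ : ∀ s → phase s ∼ twisted σ⟨ s ⟩
  phase∼ s = ∼-+ (∼-exponent c) (∼-sum λ i → ∼-*ˡ (bit (σ⟨ s ⟩ i)) (∼-affine (a i) (b i)))

  twist : Bits n → Bits n → ℤ
  twist σ x = sum (λ i → bit (lookup σ i) * bit (lookup x i))

  twist≡ : ∀ σ x → Supp f σ → Supp f x →
    exponent c (restrict ι x) + twist σ x ≡ phase (restrict ι σ) (restrict ι x)
  twist≡ σ x σ∈ x∈ = cong (_+_ (exponent c (restrict ι x))) (sum-cong-≗ λ i →
    cong₂ (λ p q → bit p * bit q) (coordinate σ σ∈ i) (coordinate x x∈ i))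

  twist-phase : ∀ σ x → Supp f σ → Supp f x → α ^ twist σ x · f x ≈ λ₀ · α ^ phase (restrict ι σ) (restrict ι x)
  twist-phase σ x σ∈ x∈ = subst (λ m → α ^ twist σ x · f x ≈ λ₀ · α ^ m) (twist≡ σ x σ∈ x∈)
    (α^.p-absorb {f x} {λ₀} (twist σ x) (exponent c (restrict ι x))
      (subst (λ z → f x ≈ λ₀ · z · α ^ exponent c (restrict ι x)) (χ-true (free⇒dec free) x x∈) (f-form x)))

  ∈𝒜⇒even : ∀ s g → (∀ x → g x ≈ α ^ twist (point s) x · f x) → g ∈𝒜 → Even⁺ (twisted σ⟨ s ⟩)
  -- The zero function is excluded because σ = `point s` itself lies in the support.
  ∈𝒜⇒even s g g≈ (inj₁ g≈0) = contradiction (g≈0 (point s))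
    (Twist.supp-twist⁺ f g (twist (point s)) g≈ (point s) (point∈ s))
  ∈𝒜⇒even s g g≈ (inj₂ g∈𝒜) = affineForm⇒even g {λ₀} λ₀≉0 a b point
    (λ y → Twist.supp-twist⁺ f g (twist (point s)) g≈ (point y) (point∈ y))
    (λ y i → trans (coordinate (point y) (point∈ y) i) (cong (λ z → σ⟨ z ⟩ i) (restrict-point y)))
    (phase∼ s)
    (λ y → ≈-trans {g (point y)} {α ^ twist (point s) (point y) · f (point y)} {λ₀ · α ^ phase s y} (g≈ (point y))
      (subst₂ (λ s′ y′ → α ^ twist (point s) (point y) · f (point y) ≈ λ₀ · α ^ phase s′ y′)
        (restrict-point s) (restrict-point y) (twist-phase (point s) (point y) (point∈ s) (point∈ y))))
    g∈𝒜
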